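{- Let $n$ be odd and $k=2$. Let $\rho\in\mathbb{F}_{2^n}\setminus\{0,1\}$, $\sigma=1+\rho$, and put $a=\rho^{1/6}$, $b=\sigma^{1/6}$ (so $a,b\notin\{0,1\}$ and $a^6+b^6=1$). Then $$Z(\rho)=2^{2n-3}\bigl(r(a,b)-1\bigr),\qquad r(a,b):=\#\bigl\{\tau\in\mathbb{F}_{2^n}:\ (a\tau^5+b)^3=(\tau^3+1)^5\bigr\}.$$ Moreover the map $\rho\mapsto(a,b)$ is a bijection from $\mathbb{F}_{2^n}\setminus\{0,1\}$ onto $\{(a,b)\in\mathbb{F}_{2^n}^2:\ a,b\notin\{0,1\},\ a^6+b^6=1\}$.
   Context: $\mathbb{F}_{2^n}$ is the field with $2^n$ elements ($n$ odd), $\operatorname{Tr}(x)=\sum_{i=0}^{n-1}x^{2^i}$ is the absolute trace, and $\chi(x)=(-1)^{\operatorname{Tr}(x)}$. For $n$ odd, $6$ is invertible modulo $2^n-1$, so $x\mapsto x^6$ is a bijection of $\mathbb{F}_{2^n}$, and $x^{1/6}$ denotes the image of $x$ under the inverse bijection. For $k=2$: $F(x)=x^{13}$, $\delta(b)=F(b)+F(b+1)+1$, $\Delta=\{\delta(b): b\in\mathbb{F}_{2^n}\}$, $S(c)=\sum_{t\in\Delta}\chi(ct)$, and for $\rho\notin\{0,1\}$, $\sigma=1+\rho$, $Z(\rho)=\sum_{\lambda\in\mathbb{F}_{2^n}^{*}}S(\lambda)S(\lambda\rho)S(\lambda\sigma)$. -}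

module Defs where

open import Algebra.Bundles using (CommutativeRing)
open import Algebra.Structures using (IsCommutativeRing)
import Algebra.Properties.CommutativeMonoid.Sum as Sum
import Algebra.Properties.Semiring.Exp as Exp
open import Data.Bool.Base using (if_then_else_)
open import Data.Fin.Base using (Fin; toℕ)
open import Data.Fin.Properties using (inj⇒≟)
open import Data.Integer.Base as ℤ using (ℤ; 0ℤ; 1ℤ; -1ℤ)
open import Data.List.Base
  using (List; map; foldr; filter; find; deduplicate; length; tabulate)
open import Data.Maybe.Base using (fromMaybe)
open import Data.Nat.Base as ℕ using (ℕ)
open import Data.Product.Base using (∃; _×_; _,_)
open import Function.Bundles using (_↔_; Inverse)
open import Function.Properties.Inverse using (Inverse⇒Injection)
open import Level using (suc)
open import Relation.Binary.Definitions using (DecidableEquality)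
open import Relation.Binary.PropositionalEquality.Core using (_≡_; _≢_)
open import Relation.Nullary.Decidable using (does; ¬?)

record FiniteField c (q : ℕ) : Set (suc c) where
  infixl 7 _*_
  infixl 6 _+_
  field
    Carrier           : Set c
    _+_ _*_           : Carrier → Carrier → Carrier
    -_                : Carrier → Carrier
    0# 1#             : Carrier
    isCommutativeRing : IsCommutativeRing _≡_ _+_ _*_ -_ 0# 1#
    0≢1               : 0# ≢ 1#
    inverse           : ∀ x → x ≢ 0# → ∃ λ y → x * y ≡ 1#
    enumeration       : Carrier ↔ Fin q

  commutativeRing : CommutativeRing c c
  commutativeRing = record { isCommutativeRing = isCommutativeRing }

  open CommutativeRing commutativeRing public
    using (semiring; +-commutativeMonoid)
  open Exp semiring public using (_^_)
  open Sum +-commutativeMonoid public using (sum)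

  infix 4 _≟_
  _≟_ : DecidableEquality Carrier
  _≟_ = inj⇒≟ (Inverse⇒Injection enumeration)

  -- Every element of the field, exactly once.
  elements : List Carrier
  elements = tabulate (Inverse.from enumeration)

module Kasami {c} (n : ℕ) (K : FiniteField c (2 ℕ.^ n)) where
  open FiniteField K

  ∑[_] : List Carrier → (Carrier → ℤ) → ℤ
  ∑[ xs ] f = foldr ℤ._+_ 0ℤ (map f xs)

  Tr : Carrier → Carrier
  Tr x = sum {n} λ i → x ^ (2 ℕ.^ toℕ i)

  -- (-1)^Tr(x): the trace only takes the values 0 and 1.
  χ : Carrier → ℤ
  χ x = if does (Tr x ≟ 0#) then 1ℤ else -1ℤ

  F : Carrier → Carrier
  F x = x ^ 13

  δ : Carrier → Carrier
  δ b = F b + F (b + 1#) + 1#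

  -- The image of δ as a set: each value is listed once, however many
  -- preimages it has.
  Δ : List Carrier
  Δ = deduplicate _≟_ (map δ elements)

  S : Carrier → ℤ
  S x = ∑[ Δ ] λ t → χ (x * t)

  Z : Carrier → ℤ
  Z ρ = ∑[ filter (λ x → ¬? (x ≟ 0#)) elements ] λ x →
          S x ℤ.* S (x * ρ) ℤ.* S (x * (1# + ρ))

  -- The inverse of y ↦ y ^ 6, by search.  For odd n that map is a
  -- bijection of the field, so the search always finds the unique sixth
  -- root and the default value 0# is never used.
  _^1/6 : Carrier → Carrier
  x ^1/6 = fromMaybe 0# (find (λ y → y ^ 6 ≟ x) elements)

  r : Carrier → Carrier → ℕ
  r a b = length (filter (λ τ → (a * τ ^ 5 + b) ^ 3 ≟ (τ ^ 3 + 1#) ^ 5) elements)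

  ≢0,1 : Carrier → Set c
  ≢0,1 x = x ≢ 0# × x ≢ 1#

  Parameter : Set c
  Parameter = ∃ λ ρ → ≢0,1 ρ

  CurvePoint : Set c
  CurvePoint = ∃ λ ((a , b) : Carrier × Carrier) →
    ≢0,1 a × ≢0,1 b × a ^ 6 + b ^ 6 ≡ 1#

{-# OPTIONS --safe #-}
module Submission where

-- Δ is the image of g(z) = z⁶ + z⁵, and every fibre of g consists of two points with different
-- traces: if g x = g y and x ≠ y then x + y = 1 + e + e² for some e, and a parametrisation of such
-- pairs by the ratio y / x is injective, hence surjective.  So 2 S(c) = Σ_z χ(c g(z)), and since
-- Tr(x⁶) = Tr(x³), 2 S(μ⁶) = G(μ) = Σ_x χ(x³ + μ x⁵) for μ ≠ 0, while G(0) = 0.  Hence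
-- 8 Z(ρ) = Σ_μ G(μ) G(μa) G(μb), and by orthogonality in μ this is 2ⁿ Σ_{x,y} χ(x³ + y³ + z³)
-- with z⁵ = a x⁵ + b y⁵.  In the double sum the terms with y = 0 cancel as a ≠ 1; for y ≠ 0 put
-- x = τ y and sum over y³ first, which leaves 2ⁿ (r(a,b) - 1).

open import Defs
open import Algebra.Bundles using (CommutativeRing; RawRing)
import Algebra.Properties.CommutativeMonoid.Sum as Sum
import Algebra.Properties.CommutativeSemigroup as CommutativeSemigroup
import Algebra.Properties.CommutativeSemiring.Exp as CommutativeExp
import Algebra.Properties.Group as Group
import Algebra.Properties.Semiring.Exp as Exp
import Algebra.Properties.Semiring.Mult as Mult
import Algebra.Solver.Ring as RingSolver
open import Algebra.Solver.Ring.AlmostCommutativeRing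
  using (fromCommutativeSemiring; _-Raw-AlmostCommutative⟶_)
open import Algebra.Structures using (IsCommutativeMonoid)
open import Data.Bool.Base using (Bool; true; false; if_then_else_; _xor_; _∧_)
open import Data.Empty using (⊥-elim)
open import Data.Fin.Base using (Fin; zero; suc; toℕ)
import Data.Fin.Properties as Fin
open import Data.Integer.Base as ℤ using (ℤ; 0ℤ; 1ℤ; -1ℤ)
import Data.Integer.Properties as ℤ
open import Data.Integer.Tactic.RingSolver using (solve-∀)
open import Data.List.Base using (List; []; _∷_; map; foldr; filter; find; length)
import Data.List.Properties as List
open import Data.List.Membership.Propositional using (_∈_)
open import Data.List.Membership.Propositional.Properties
  using (∈-map⁺; ∈-map⁻; ∈-filter⁺; ∈-filter⁻; ∈-tabulate⁺; ∈-deduplicate⁺; ∈-deduplicate⁻)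
open import Data.List.Membership.Propositional.Properties.WithK using (unique∧set⇒bag)
open import Data.List.Relation.Binary.BagAndSetEquality using (∼bag⇒↭)
open import Data.List.Relation.Binary.Permutation.Propositional using (_↭_; ↭⇒↭ₛ)
import Data.List.Relation.Binary.Permutation.Propositional.Properties as ↭
import Data.List.Relation.Binary.Permutation.Setoid.Properties as ↭ₛ
open import Data.List.Relation.Unary.All as All using (All)
open import Data.List.Relation.Unary.AllPairs using ([]; _∷_)
open import Data.List.Relation.Unary.Any using (here; there)
open import Data.List.Relation.Unary.Unique.Propositional using (Unique)
import Data.List.Relation.Unary.Unique.DecPropositional.Properties as DecUnique
import Data.List.Relation.Unary.Unique.Propositional.Properties as Unique
open import Data.Maybe.Base using (Maybe; just; nothing; fromMaybe)
open import Data.Nat.Base as ℕ using (ℕ; zero; suc; _∸_)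
open import Data.Nat.DivMod using (_%_; _/_; m≡m%n+[m/n]*n)
import Data.Nat.Properties as ℕ
open import Data.Product.Base using (∃; _×_; _,_; proj₁; proj₂)
open import Data.Sum.Base using (_⊎_; inj₁; inj₂)
open import Function.Base using (_∘_; id; _on_)
open import Function.Bundles using (Inverse; mk⇔)
open import Function.Definitions using (Injective; Bijective)
open import Relation.Binary.PropositionalEquality hiding (J)
open import Relation.Nullary using (Dec; does; yes; no; ¬?; contradiction)
open import Relation.Nullary.Decidable using (dec-true; dec-false)
open import Relation.Unary using (Pred; Decidable)

-- `Δ` lists values without multiplicity, so `S` becomes a sum over the field only once the exact
-- size of the fibres is known. As `δ b` is unchanged by b ↦ b + 1, it is a polynomial in b² + b,
-- and in z = b² + b + 1 only two terms survive: this is `g`. Here z runs over the elements of trace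
-- 1, because Tr 1 = 1 for odd n. The trace identity bounds a fibre by two points; that no fibre is
-- a single point does not follow from it, and the pigeonhole argument on ratios supplies this. Each
-- level set of the trace then meets every fibre exactly once, so `Δ`, which comes from trace 1
-- alone, is the whole image. Sixth roots enter because c = μ⁶ turns c z⁶ into (μz)⁶ and c z⁵ into μ
-- (μz)⁵: the parameter multiplies only the fifth power, so orthogonality in μ applies. The
-- exponents 3 and 5 are prime to 2^n - 1 for odd n, so the fifth root z is unique and y³ runs over
-- the field. Clearing that root from τ³ + 1 + z³ = 0 by a fifth power gives the equation counted by
-- `r`.

module _ {a} {A : Set a} where

  -- Every change of summation range below, along a bijection of the field or from a trace level set
  -- to `Δ`, reduces through this to comparing membership.
  unique∧set⇒↭ : {xs ys : List A} → Unique xs → Unique ys →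
    (∀ {x} → x ∈ xs → x ∈ ys) → (∀ {x} → x ∈ ys → x ∈ xs) → xs ↭ ys
  unique∧set⇒↭ xs! ys! ⊆ ⊇ = ∼bag⇒↭ (unique∧set⇒bag xs! ys! (mk⇔ ⊆ ⊇))

module _ {a b} {A : Set a} {B : Set b} where

  -- Injectivity is asked only on the members of `xs`, since `g` is injective on a level set of the
  -- trace but not on the field.
  map-unique : ∀ (f : A → B) {xs} → (∀ {x y} → x ∈ xs → y ∈ xs → f x ≡ f y → x ≡ y) →
    Unique xs → Unique (map f xs)
  map-unique f inj []         = []
  map-unique f inj (x∉ ∷ xs!) = All.tabulate (λ fy∈ fx≡ → let y , y∈ , p = ∈-map⁻ f fy∈ in
      All.lookup x∉ y∈ (inj (here refl) (there y∈) (trans fx≡ p)))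
    ∷ map-unique f (λ x∈ y∈ → inj (there x∈) (there y∈)) xs!

-- Sums and products over lists.

module Fold {a b} {A : Set a} {B : Set b} {_∙_ : B → B → B} {ε : B}
  (isCommutativeMonoid : IsCommutativeMonoid _≡_ _∙_ ε) where

  open IsCommutativeMonoid isCommutativeMonoid using (identityˡ; assoc; comm; isCommutativeSemigroup)

  ⨀ : List A → (A → B) → B
  ⨀ xs f = foldr _∙_ ε (map f xs)

  ⨀-cong : ∀ xs {f g : A → B} → (∀ x → f x ≡ g x) → ⨀ xs f ≡ ⨀ xs g
  ⨀-cong xs f≗g = cong (foldr _∙_ ε) (List.map-cong f≗g xs)

  ⨀-↭ : ∀ {xs ys} (f : A → B) → xs ↭ ys → ⨀ xs f ≡ ⨀ ys f
  ⨀-↭ f p = ↭ₛ.foldr-commMonoid (setoid B) isCommutativeMonoid (↭⇒↭ₛ (↭.map⁺ f p))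

  ⨀-∙ : ∀ xs (f g : A → B) → ⨀ xs (λ x → f x ∙ g x) ≡ ⨀ xs f ∙ ⨀ xs g
  ⨀-∙ []       f g = sym (identityˡ ε)
  ⨀-∙ (x ∷ xs) f g = trans (cong ((f x ∙ g x) ∙_) (⨀-∙ xs f g))
    (CommutativeSemigroup.interchange (record { isCommutativeSemigroup = isCommutativeSemigroup })
      (f x) (g x) _ _)

  ⨀-ε : ∀ xs → ⨀ xs (λ _ → ε) ≡ ε
  ⨀-ε []       = refl
  ⨀-ε (x ∷ xs) = trans (identityˡ _) (⨀-ε xs)

  ⨀-cong-∈ : ∀ {xs} {f g : A → B} → (∀ {x} → x ∈ xs → f x ≡ g x) → ⨀ xs f ≡ ⨀ xs g
  ⨀-cong-∈ f≗g = cong (foldr _∙_ ε) (List.map-cong-local (All.tabulate f≗g))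

  ⨀-map : ∀ xs (f : A → B) (g : A → A) → ⨀ (map g xs) f ≡ ⨀ xs (f ∘ g)
  ⨀-map xs f g = cong (foldr _∙_ ε) (sym (List.map-∘ xs))

  ⨀-swap : ∀ xs ys (f : A → A → B) → ⨀ xs (λ x → ⨀ ys (f x)) ≡ ⨀ ys (λ y → ⨀ xs (λ x → f x y))
  ⨀-swap []       ys f = sym (⨀-ε ys)
  ⨀-swap (x ∷ xs) ys f = trans (cong (⨀ ys (f x) ∙_) (⨀-swap xs ys f)) (sym (⨀-∙ ys (f x) _))

  ⨀-filter : ∀ {p} {P : Pred A p} (P? : Decidable P) xs (f : A → B) →
    ⨀ xs f ≡ ⨀ (filter P? xs) f ∙ ⨀ (filter (¬? ∘ P?) xs) f
  ⨀-filter P? []       f = sym (identityˡ ε)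
  ⨀-filter P? (x ∷ xs) f with P? x
  ... | yes _ = trans (cong (f x ∙_) (⨀-filter P? xs f)) (sym (assoc _ _ _))
  ... | no _  = trans (cong (f x ∙_) (trans (⨀-filter P? xs f) (comm _ _)))
    (trans (sym (assoc _ _ _)) (comm _ _))

-- General facts on finite fields.

module FieldProperties {c q} (K : FiniteField c q) where

  open FiniteField K
  open CommutativeRing commutativeRing public
    using (+-comm; +-assoc; +-identityˡ; +-identityʳ; *-comm; *-assoc; *-identityˡ; *-identityʳ;
           zeroˡ; zeroʳ; +-isCommutativeMonoid;
           *-isCommutativeMonoid; commutativeSemiring)
  open Exp semiring public using (^-assocʳ)
  open CommutativeExp commutativeSemiring public using (^-distrib-*)
  open Mult semiring using (×1-homo-*) renaming (_×_ to _·_)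
  open Group (CommutativeRing.+-group commutativeRing)
    public using () renaming (∙-cancelʳ to +-cancelʳ)

  ∈-elements : ∀ x → x ∈ elements
  ∈-elements x = subst (_∈ elements) (Inverse.strictlyInverseʳ enumeration x)
    (∈-tabulate⁺ (Inverse.to enumeration x))

  from-injective : Injective _≡_ _≡_ (Inverse.from enumeration)
  from-injective {i} {j} p = trans (sym (Inverse.strictlyInverseˡ enumeration i))
    (trans (cong (Inverse.to enumeration) p) (Inverse.strictlyInverseˡ enumeration j))

  to-injective : Injective _≡_ _≡_ (Inverse.to enumeration)
  to-injective {x} {y} p = trans (sym (Inverse.strictlyInverseʳ enumeration x))
    (trans (cong (Inverse.from enumeration) p) (Inverse.strictlyInverseʳ enumeration y))

  elements-unique : Unique elements
  elements-unique = Unique.tabulate⁺ from-injective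

  length-elements : length elements ≡ q
  length-elements = List.length-tabulate _

  -- Pigeonhole: a missed value `y`, added as one more value, would give an injection `h` from
  -- `Fin (suc q)` into `Fin q`.
  injective⇒surjective : ∀ {f : Carrier → Carrier} → Injective _≡_ _≡_ f → ∀ y → ∃ λ x → f x ≡ y
  injective⇒surjective {f} f-inj y with Fin.any? (λ i → f (Inverse.from enumeration i) ≟ y)
  ... | yes (i , p) = _ , p
  ... | no ∄x = ⊥-elim (Fin.<⇒notInjective (ℕ.n<1+n q) h-inj)
    where
    h : Fin (suc q) → Fin q
    h zero    = Inverse.to enumeration y
    h (suc i) = Inverse.to enumeration (f (Inverse.from enumeration i))
    h-inj : Injective _≡_ _≡_ h
    h-inj {zero}  {zero}  _ = refl
    h-inj {zero}  {suc j} p = ⊥-elim (∄x (j , sym (to-injective p)))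
    h-inj {suc i} {zero}  p = ⊥-elim (∄x (i , to-injective p))
    h-inj {suc i} {suc j} p = cong suc (from-injective (f-inj (to-injective p)))

  map-elements-↭ : ∀ {f : Carrier → Carrier} → Injective _≡_ _≡_ f → map f elements ↭ elements
  map-elements-↭ {f} f-inj = unique∧set⇒↭ (Unique.map⁺ f-inj elements-unique) elements-unique
    (λ _ → ∈-elements _)
    (λ {y} _ → let x , p = injective⇒surjective f-inj y in subst (_∈ _) p (∈-map⁺ f (∈-elements x)))

  others : Carrier → List Carrier
  others x₀ = filter (λ x → ¬? (x ≟ x₀)) elements

  ∈-others : ∀ {x x₀} → x ∈ others x₀ → x ≢ x₀
  ∈-others {x₀ = x₀} x∈ = proj₂ (∈-filter⁻ (λ x → ¬? (x ≟ x₀)) {xs = elements} x∈)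

  elements-↭-∷ : ∀ x₀ → elements ↭ x₀ ∷ others x₀
  elements-↭-∷ x₀ = unique∧set⇒↭ elements-unique
    (All.tabulate (λ x∈ p → ∈-others x∈ (sym p)) ∷ Unique.filter⁺ P? elements-unique)
    (λ {x} _ → split x) (λ _ → ∈-elements _)
    where
    P? = λ x → ¬? (x ≟ x₀)
    split : ∀ x → x ∈ x₀ ∷ others x₀
    split x with x ≟ x₀
    ... | yes p = here p
    ... | no ¬p = there (∈-filter⁺ P? (∈-elements x) ¬p)

  map-others-↭ : ∀ {f : Carrier → Carrier} → Injective _≡_ _≡_ f → ∀ x₀ → f x₀ ≡ x₀ →
    map f (others x₀) ↭ others x₀
  map-others-↭ {f} f-inj x₀ fx₀ = unique∧set⇒↭
    (Unique.map⁺ f-inj (Unique.filter⁺ P? elements-unique)) (Unique.filter⁺ P? elements-unique)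
    (λ y∈ → let x , x∈ , p = ∈-map⁻ f y∈ in
      ∈-filter⁺ P? (∈-elements _) λ y≡x₀ →
        ∈-others x∈ (f-inj (trans (sym p) (trans y≡x₀ (sym fx₀)))))
    (λ {y} y∈ → let x , p = injective⇒surjective f-inj y in
      subst (_∈ _) p (∈-map⁺ f (∈-filter⁺ P? (∈-elements x) λ x≡x₀ →
        ∈-others y∈ (trans (sym p) (trans (cong f x≡x₀) fx₀)))))
    where P? = λ x → ¬? (x ≟ x₀)

  *-cancelˡ : ∀ {z x y} → z ≢ 0# → z * x ≡ z * y → x ≡ y
  *-cancelˡ {z} {x} {y} z≢0 p = trans (sym (lemma x)) (trans (cong (z⁻¹ *_) p) (lemma y))
    where
    z⁻¹ = proj₁ (inverse z z≢0)
    lemma : ∀ u → z⁻¹ * (z * u) ≡ u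
    lemma u = trans (sym (*-assoc z⁻¹ z u)) (trans (cong (_* u)
      (trans (*-comm z⁻¹ z) (proj₂ (inverse z z≢0)))) (*-identityˡ u))

  x*y≡0⇒y≡0 : ∀ {x y} → x ≢ 0# → x * y ≡ 0# → y ≡ 0#
  x*y≡0⇒y≡0 {x} x≢0 p = *-cancelˡ x≢0 (trans p (sym (zeroʳ x)))

  x*y≢0 : ∀ {x y} → x ≢ 0# → y ≢ 0# → x * y ≢ 0#
  x*y≢0 x≢0 y≢0 p = y≢0 (x*y≡0⇒y≡0 x≢0 p)

  x^k≢0 : ∀ {x} k → x ≢ 0# → x ^ k ≢ 0#
  x^k≢0 zero    x≢0 p = 0≢1 (sym p)
  x^k≢0 (suc k) x≢0   = x*y≢0 x≢0 (x^k≢0 k x≢0)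

  *-injective : ∀ {z} → z ≢ 0# → Injective _≡_ _≡_ (z *_)
  *-injective z≢0 = *-cancelˡ z≢0

  module ∑+ = Fold {A = Carrier} +-isCommutativeMonoid
  module ∏ = Fold {A = Carrier} *-isCommutativeMonoid

  -- Translation by `1#` permutes the field, so the sum `s` of all elements does not change when
  -- `1#` is added to each of the `q` terms.
  q·1≡0 : q · 1# ≡ 0#
  q·1≡0 = +-cancelʳ s _ _ (begin
    q · 1# + s                                   ≡⟨ cong (λ k → k · 1# + s) length-elements ⟨
    length elements · 1# + s                     ≡⟨ cong (_+ s) (const elements) ⟨
    ∑+.⨀ elements (λ _ → 1#) + s                 ≡⟨ ∑+.⨀-∙ elements (λ _ → 1#) id ⟨
    ∑+.⨀ elements (1# +_)                        ≡⟨ ∑+.⨀-map elements id (1# +_) ⟨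
    ∑+.⨀ (map (1# +_) elements) id               ≡⟨ ∑+.⨀-↭ id (map-elements-↭ 1+-inj) ⟩
    s                                            ≡⟨ +-identityˡ s ⟨
    0# + s                                       ∎)
    where
    open ≡-Reasoning
    s = ∑+.⨀ elements id
    1+-inj : Injective _≡_ _≡_ (1# +_)
    1+-inj {x} {y} p = +-cancelʳ 1# x y (trans (+-comm x 1#) (trans p (+-comm 1# y)))
    const : ∀ xs → ∑+.⨀ xs (λ _ → 1#) ≡ length xs · 1#
    const []       = refl
    const (x ∷ xs) = cong (1# +_) (const xs)

  suc-length-others : ∀ x₀ → suc (length (others x₀)) ≡ q
  suc-length-others x₀ = trans (sym (↭.↭-length (elements-↭-∷ x₀))) length-elements

  -- Multiplication by a nonzero `x` permutes the nonzero elements, and their product can be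
  -- cancelled.
  x^q≡x : ∀ x → x ^ q ≡ x
  x^q≡x x with x ≟ 0#
  -- Writing `q` as a successor exposes a factor `0#` here, and a factor `x` in the other case.
  ... | yes refl = subst (λ k → 0# ^ k ≡ 0#) (suc-length-others 0#) (zeroˡ _)
  ... | no x≢0 = subst (λ k → x ^ k ≡ x) (suc-length-others 0#)
    (trans (cong (x *_) x^[q-1]≡1) (*-identityʳ x))
    where
    open ≡-Reasoning
    nz = others 0#
    const : ∀ xs → ∏.⨀ xs (λ _ → x) ≡ x ^ length xs
    const []       = refl
    const (y ∷ ys) = cong (x *_) (const ys)
    ∏≢0 : ∀ {xs} → All (_≢ 0#) xs → ∏.⨀ xs id ≢ 0#
    ∏≢0 All.[]       p = 0≢1 (sym p)
    ∏≢0 (x≢0 All.∷ xs≢0) = x*y≢0 x≢0 (∏≢0 xs≢0)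
    x^[q-1]≡1 : x ^ length nz ≡ 1#
    x^[q-1]≡1 = *-cancelˡ (∏≢0 {nz} (All.tabulate ∈-others))
      (begin
      ∏.⨀ nz id * x ^ length nz     ≡⟨ *-comm _ _ ⟩
      x ^ length nz * ∏.⨀ nz id     ≡⟨ cong (_* ∏.⨀ nz id) (const nz) ⟨
      ∏.⨀ nz (λ _ → x) * ∏.⨀ nz id  ≡⟨ ∏.⨀-∙ nz (λ _ → x) id ⟨
      ∏.⨀ nz (x *_)                 ≡⟨ ∏.⨀-map nz id (x *_) ⟨
      ∏.⨀ (map (x *_) nz) id        ≡⟨ ∏.⨀-↭ id (map-others-↭ (*-injective x≢0) 0# (zeroʳ x)) ⟩
      ∏.⨀ nz id                     ≡⟨ *-identityʳ _ ⟨
      ∏.⨀ nz id * 1#                ∎)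

  2^k·1≡[1+1]^k : ∀ k → (2 ℕ.^ k) · 1# ≡ (1# + 1#) ^ k
  2^k·1≡[1+1]^k zero    = +-identityʳ 1#
  2^k·1≡[1+1]^k (suc k) = trans (×1-homo-* 2 (2 ℕ.^ k))
    (cong₂ _*_ (cong (1# +_) (+-identityʳ 1#)) (2^k·1≡[1+1]^k k))

  -- The image of 2^k in the field is the k-th power of `1# + 1#`; it is zero, and a field has no
  -- nonzero nilpotents.
  1+1≡0 : ∀ k → q ≡ 2 ℕ.^ k → 1# + 1# ≡ 0#
  1+1≡0 k refl with 1# + 1# ≟ 0#
  ... | yes p = p
  ... | no ¬p = ⊥-elim (x^k≢0 k ¬p (trans (sym (2^k·1≡[1+1]^k k)) q·1≡0))

-- Algebra in characteristic 2.

module Char2 {c q} (K : FiniteField c q)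
  (1+1≡0# : FiniteField._+_ K (FiniteField.1# K) (FiniteField.1# K) ≡ FiniteField.0# K) where

  open FiniteField K
  open FieldProperties K

  private
    -- The two-element field as coefficient ring: normalisation then cancels equal monomials in
    -- pairs, so polynomial identities modulo 2 hold by `refl`.
    Bool-ring : RawRing _ _
    Bool-ring = record
      { Carrier = Bool ; _≈_ = _≡_ ; _+_ = _xor_ ; _*_ = _∧_ ; -_ = id ; 0# = false ; 1# = true }

    ⟦_⟧ : Bool → Carrier
    ⟦ false ⟧ = 0#
    ⟦ true  ⟧ = 1#

    Bool⟶K : Bool-ring -Raw-AlmostCommutative⟶ fromCommutativeSemiring commutativeSemiring
    Bool⟶K = record
      { ⟦_⟧    = ⟦_⟧
      ; +-homo = λ { false false → sym (+-identityˡ 0#) ; false true → sym (+-identityˡ 1#)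
                   ; true false → sym (+-identityʳ 1#) ; true true → sym 1+1≡0# }
      ; *-homo = λ { false y → sym (zeroˡ ⟦ y ⟧) ; true y → sym (*-identityˡ ⟦ y ⟧) }
      ; -‿homo = λ _ → refl
      ; 0-homo = refl
      ; 1-homo = refl
      }

    _≟ᵇ_ : ∀ x y → Maybe (⟦ x ⟧ ≡ ⟦ y ⟧)
    false ≟ᵇ false = just refl
    true  ≟ᵇ true  = just refl
    _     ≟ᵇ _     = nothing

  module Solver = RingSolver Bool-ring (fromCommutativeSemiring commutativeSemiring) Bool⟶K _≟ᵇ_
  open Solver using (solve; con; _:+_; _:*_; _:^_; _:=_)

  x+x≡0 : ∀ x → x + x ≡ 0#
  x+x≡0 = solve 1 (λ x → x :+ x := con false) refl

  x≡y⇒x+y≡0 : ∀ {x y} → x ≡ y → x + y ≡ 0#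
  x≡y⇒x+y≡0 refl = x+x≡0 _

  x+y≡z⇒x≡z+y : ∀ {x y z} → x + y ≡ z → x ≡ z + y
  x+y≡z⇒x≡z+y {x} {y} refl = solve 2 (λ x y → x := (x :+ y) :+ y) refl x y

  x+y≡0⇒x≡y : ∀ {x y} → x + y ≡ 0# → x ≡ y
  x+y≡0⇒x≡y p = trans (x+y≡z⇒x≡z+y p) (+-identityˡ _)

  x≢y⇒x+y≢0 : ∀ {x y} → x ≢ y → x + y ≢ 0#
  x≢y⇒x+y≢0 x≢y p = x≢y (x+y≡0⇒x≡y p)

  x^2≡x⇒x∈01 : ∀ {x} → x ^ 2 ≡ x → x ≡ 0# ⊎ x ≡ 1#
  x^2≡x⇒x∈01 {x} p with x ≟ 0#
  ... | yes x≡0 = inj₁ x≡0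
  ... | no x≢0 = inj₂ (*-cancelˡ x≢0
    (trans (sym (cong (x *_) (*-identityʳ x))) (trans p (sym (*-identityʳ x)))))

  x^k≢0⇒x≢0 : ∀ {x} k → x ^ suc k ≢ 0# → x ≢ 0#
  x^k≢0⇒x≢0 k p refl = p (zeroˡ _)

  1^k≡1 : ∀ k → 1# ^ k ≡ 1#
  1^k≡1 zero    = refl
  1^k≡1 (suc k) = trans (*-identityˡ _) (1^k≡1 k)

  -- For nonzero `y` the quotient of `x` by `y` is a root of unity, so a trivial kernel on the
  -- multiplicative group suffices; zero is treated apart.
  ^-injective : ∀ k → (∀ {s} → s ^ suc k ≡ 1# → s ≡ 1#) → Injective _≡_ _≡_ (_^ suc k)
  ^-injective k unique {x} {y} p with y ≟ 0#
  ... | yes refl with x ≟ 0#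
  ...   | yes x≡0 = x≡0
  ...   | no x≢0 = ⊥-elim (x^k≢0 (suc k) x≢0 (trans p (zeroˡ _)))
  ^-injective k unique {x} {y} p | no y≢0 =
    trans x≡ys (trans (cong (y *_) (unique s^k≡1)) (*-identityʳ y))
    where
    y⁻¹ = proj₁ (inverse y y≢0)
    s = x * y⁻¹
    x≡ys : x ≡ y * s
    x≡ys = trans (sym (*-identityʳ x)) (trans (cong (x *_) (sym (proj₂ (inverse y y≢0))))
      (solve 3 (λ x y z → x :* (y :* z) := y :* (x :* z)) refl x y y⁻¹))
    s^k≡1 : s ^ suc k ≡ 1#
    s^k≡1 = *-cancelˡ (x^k≢0 (suc k) y≢0) (trans (sym (^-distrib-* y s (suc k)))
      (trans (cong (_^ suc k) (sym x≡ys)) (trans p (sym (*-identityʳ _)))))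

  ^2-injective : Injective _≡_ _≡_ (_^ 2)
  ^2-injective = ^-injective 1 λ {s} p → x+y≡0⇒x≡y (square≡0 (trans
    (solve 1 (λ s → (s :+ con true) :^ 2 := s :^ 2 :+ con true) refl s) (x≡y⇒x+y≡0 p)))
    where
    square≡0 : ∀ {x} → x ^ 2 ≡ 0# → x ≡ 0#
    square≡0 {x} p with x ≟ 0#
    ... | yes x≡0 = x≡0
    ... | no x≢0 = ⊥-elim (x^k≢0 2 x≢0 p)

  x^2^j≡x⇒x^2^kj≡x : ∀ j k {x} → x ^ (2 ℕ.^ j) ≡ x → x ^ (2 ℕ.^ (k ℕ.* j)) ≡ x
  x^2^j≡x⇒x^2^kj≡x j zero    {x} p = *-identityʳ x
  x^2^j≡x⇒x^2^kj≡x j (suc k) {x} p = begin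
    x ^ (2 ℕ.^ (j ℕ.+ k ℕ.* j))             ≡⟨ cong (x ^_) (ℕ.^-distribˡ-+-* 2 j (k ℕ.* j)) ⟩
    x ^ (2 ℕ.^ j ℕ.* 2 ℕ.^ (k ℕ.* j))       ≡⟨ ^-assocʳ x (2 ℕ.^ j) _ ⟨
    (x ^ (2 ℕ.^ j)) ^ (2 ℕ.^ (k ℕ.* j))     ≡⟨ cong (_^ (2 ℕ.^ (k ℕ.* j))) p ⟩
    x ^ (2 ℕ.^ (k ℕ.* j))                   ≡⟨ x^2^j≡x⇒x^2^kj≡x j k p ⟩
    x                                       ∎
    where open ≡-Reasoning

-- Third, fifth and sixth powers in odd degree.

module OddDegree {c} (n m : ℕ) (n≡1+m*2 : n ≡ suc (m ℕ.* 2)) (K : FiniteField c (2 ℕ.^ n)) where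

  open FiniteField K
  open FieldProperties K
  open Char2 K (1+1≡0 n refl) public
  open Kasami n K
  open Solver using (solve; con; _:+_; _:*_; _:^_; _:=_)
  open ≡-Reasoning

  q : ℕ
  q = 2 ℕ.^ n

  -- Squaring n times fixes s, but as s⁴ = s and n is odd it amounts to squaring once.
  s^3≡1⇒s≡1 : ∀ {s} → s ^ 3 ≡ 1# → s ≡ 1#
  s^3≡1⇒s≡1 {s} s^3≡1 with x^2≡x⇒x∈01 (sym s≡s^2)
    where
    s^4≡s : s ^ 4 ≡ s
    s^4≡s = trans (cong (s *_) s^3≡1) (*-identityʳ s)
    s≡s^2 : s ≡ s ^ 2
    s≡s^2 = begin
      s                                 ≡⟨ x^q≡x s ⟨
      s ^ (2 ℕ.^ n)                     ≡⟨ cong (λ k → s ^ (2 ℕ.^ k)) n≡1+m*2 ⟩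
      s ^ (2 ℕ.* 2 ℕ.^ (m ℕ.* 2))       ≡⟨ ^-assocʳ s 2 (2 ℕ.^ (m ℕ.* 2)) ⟨
      (s ^ 2) ^ (2 ℕ.^ (m ℕ.* 2))       ≡⟨ x^2^j≡x⇒x^2^kj≡x 2 m (trans
        (solve 1 (λ s → (s :^ 2) :^ 4 := (s :^ 4) :^ 2) refl s) (cong (_^ 2) s^4≡s)) ⟩
      s ^ 2                             ∎
  ... | inj₁ refl = trans (sym (zeroˡ _)) s^3≡1
  ... | inj₂ s≡1 = s≡1

  -- Such an `s` satisfies s^16 = s, so four squarings fix it. Since 2n = 2 + 4m, squaring 2n times
  -- amounts to squaring twice, and it also fixes `s`. Thus s^4 = s, which leaves a cube root of
  -- unity.
  s^5≡1⇒s≡1 : ∀ {s} → s ^ 5 ≡ 1# → s ≡ 1#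
  s^5≡1⇒s≡1 {s} s^5≡1 = s^3≡1⇒s≡1 (*-cancelˡ s≢0 (trans s^4≡s (sym (*-identityʳ s))))
    where
    s≢0 : s ≢ 0#
    s≢0 = x^k≢0⇒x≢0 4 λ p → 0≢1 (trans (sym p) s^5≡1)
    s^16≡s : s ^ 16 ≡ s
    s^16≡s = trans (solve 1 (λ s → s :^ 16 := (s :^ 5) :^ 3 :* s) refl s)
      (trans (cong (λ t → t ^ 3 * s) s^5≡1) (trans (cong (_* s) (1^k≡1 3)) (*-identityˡ s)))
    n+n≡2+m*4 : n ℕ.+ n ≡ 2 ℕ.+ m ℕ.* 4
    n+n≡2+m*4 = trans (cong₂ ℕ._+_ n≡1+m*2 n≡1+m*2) (cong suc (trans (ℕ.+-suc _ _)
      (cong suc (sym (ℕ.*-distribˡ-+ m 2 2)))))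
    s^4≡s : s ^ 4 ≡ s
    s^4≡s = begin
      s ^ 4                              ≡⟨ x^2^j≡x⇒x^2^kj≡x 4 m (trans
        (solve 1 (λ s → (s :^ 4) :^ 16 := (s :^ 16) :^ 4) refl s) (cong (_^ 4) s^16≡s)) ⟨
      (s ^ 4) ^ (2 ℕ.^ (m ℕ.* 4))        ≡⟨ ^-assocʳ s 4 (2 ℕ.^ (m ℕ.* 4)) ⟩
      s ^ (4 ℕ.* 2 ℕ.^ (m ℕ.* 4))        ≡⟨ cong (s ^_) (ℕ.^-distribˡ-+-* 2 2 (m ℕ.* 4)) ⟨
      s ^ (2 ℕ.^ (2 ℕ.+ m ℕ.* 4))        ≡⟨ cong (λ k → s ^ (2 ℕ.^ k)) n+n≡2+m*4 ⟨
      s ^ (2 ℕ.^ (n ℕ.+ n))              ≡⟨ cong (s ^_) (ℕ.^-distribˡ-+-* 2 n n) ⟩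
      s ^ (q ℕ.* q)                      ≡⟨ ^-assocʳ s q q ⟨
      (s ^ q) ^ q                        ≡⟨ trans (x^q≡x _) (x^q≡x s) ⟩
      s                                  ∎

  ^3-injective : Injective _≡_ _≡_ (_^ 3)
  ^3-injective = ^-injective 2 s^3≡1⇒s≡1

  ^5-injective : Injective _≡_ _≡_ (_^ 5)
  ^5-injective = ^-injective 4 s^5≡1⇒s≡1

  ^6-injective : Injective _≡_ _≡_ (_^ 6)
  ^6-injective {x} {y} p = ^2-injective (^3-injective
    (trans (^-assocʳ x 2 3) (trans p (sym (^-assocʳ y 2 3)))))

  -- Partial traces, the trace, and the equation b² + b = y.

  T : ℕ → Carrier → Carrier
  T k x = sum {k} λ i → x ^ (2 ℕ.^ toℕ i)

  T-suc : ∀ k x → T (suc k) x ≡ x + T k (x ^ 2)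
  T-suc k x = cong₂ _+_ (*-identityʳ x)
    (Sum.sum-cong-≗ +-commutativeMonoid {n = k} λ i → sym (^-assocʳ x 2 (2 ℕ.^ toℕ i)))

  T-+ : ∀ k x y → T k (x + y) ≡ T k x + T k y
  T-+ zero    x y = sym (+-identityˡ 0#)
  T-+ (suc k) x y = begin
    T (suc k) (x + y)                       ≡⟨ T-suc k (x + y) ⟩
    x + y + T k ((x + y) ^ 2)               ≡⟨ cong (λ t → x + y + T k t)
      (solve 2 (λ x y → (x :+ y) :^ 2 := x :^ 2 :+ y :^ 2) refl x y) ⟩
    x + y + T k (x ^ 2 + y ^ 2)             ≡⟨ cong (x + y +_) (T-+ k (x ^ 2) (y ^ 2)) ⟩
    x + y + (T k (x ^ 2) + T k (y ^ 2))     ≡⟨ solve 4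
      (λ x y u v → x :+ y :+ (u :+ v) := x :+ u :+ (y :+ v)) refl x y _ _ ⟩
    x + T k (x ^ 2) + (y + T k (y ^ 2))     ≡⟨ cong₂ _+_ (T-suc k x) (T-suc k y) ⟨
    T (suc k) x + T (suc k) y               ∎

  T-^2 : ∀ k x → T k (x ^ 2) ≡ T k x ^ 2
  T-^2 zero    x = solve 0 (con false := con false :^ 2) refl
  T-^2 (suc k) x = begin
    T (suc k) (x ^ 2)              ≡⟨ T-suc k (x ^ 2) ⟩
    x ^ 2 + T k ((x ^ 2) ^ 2)      ≡⟨ cong (x ^ 2 +_) (T-^2 k (x ^ 2)) ⟩
    x ^ 2 + T k (x ^ 2) ^ 2        ≡⟨ solve 2 (λ x y → x :^ 2 :+ y :^ 2 := (x :+ y) :^ 2) refl x _ ⟩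
    (x + T k (x ^ 2)) ^ 2          ≡⟨ cong (_^ 2) (T-suc k x) ⟨
    T (suc k) x ^ 2                ∎

  T-last : ∀ k x → T (suc k) x ≡ T k x + x ^ (2 ℕ.^ k)
  T-last zero    x = +-comm _ _
  T-last (suc k) x = begin
    T (suc (suc k)) x                            ≡⟨ T-suc (suc k) x ⟩
    x + T (suc k) (x ^ 2)                        ≡⟨ cong (x +_) (T-last k (x ^ 2)) ⟩
    x + (T k (x ^ 2) + (x ^ 2) ^ (2 ℕ.^ k))      ≡⟨ +-assoc _ _ _ ⟨
    x + T k (x ^ 2) + (x ^ 2) ^ (2 ℕ.^ k)        ≡⟨ cong₂ _+_ (sym (T-suc k x)) (^-assocʳ x 2 (2 ℕ.^ k)) ⟩
    T (suc k) x + x ^ (2 ℕ.^ suc k)              ∎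

  Tr-+ : ∀ x y → Tr (x + y) ≡ Tr x + Tr y
  Tr-+ = T-+ n

  -- Removing the first term of `T (suc n) x` leaves `Tr (x ^ 2)`, removing the last leaves `Tr x`,
  -- and the removed terms `x` and `x ^ q` agree.
  Tr-^2 : ∀ x → Tr (x ^ 2) ≡ Tr x
  Tr-^2 x = +-cancelʳ x _ _ (begin
    Tr (x ^ 2) + x       ≡⟨ +-comm _ _ ⟩
    x + Tr (x ^ 2)       ≡⟨ T-suc n x ⟨
    T (suc n) x          ≡⟨ T-last n x ⟩
    Tr x + x ^ q         ≡⟨ cong (Tr x +_) (x^q≡x x) ⟩
    Tr x + x             ∎)

  Tr∈01 : ∀ x → Tr x ≡ 0# ⊎ Tr x ≡ 1#
  Tr∈01 x = x^2≡x⇒x∈01 (trans (sym (T-^2 n x)) (Tr-^2 x))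

  Tr-0 : Tr 0# ≡ 0#
  Tr-0 = trans (cong Tr (sym (x+x≡0 0#))) (trans (Tr-+ 0# 0#) (x+x≡0 _))

  Tr-1 : Tr 1# ≡ 1#
  Tr-1 = subst (λ k → T k 1# ≡ 1#) (sym n≡1+m*2) (odd m)
    where
    odd : ∀ j → T (suc (j ℕ.* 2)) 1# ≡ 1#
    odd zero    = solve 0 (con true :^ 1 :+ con false := con true) refl
    odd (suc j) = begin
      T (3 ℕ.+ j ℕ.* 2) 1#                     ≡⟨ T-suc (2 ℕ.+ j ℕ.* 2) 1# ⟩
      1# + T (2 ℕ.+ j ℕ.* 2) (1# ^ 2)          ≡⟨ cong (λ x → 1# + T (2 ℕ.+ j ℕ.* 2) x) (1^k≡1 2) ⟩
      1# + T (2 ℕ.+ j ℕ.* 2) 1#                ≡⟨ cong (1# +_) (T-suc (1 ℕ.+ j ℕ.* 2) 1#) ⟩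
      1# + (1# + T (1 ℕ.+ j ℕ.* 2) (1# ^ 2))   ≡⟨ cong (λ x → 1# + (1# + T (1 ℕ.+ j ℕ.* 2) x)) (1^k≡1 2) ⟩
      1# + (1# + T (1 ℕ.+ j ℕ.* 2) 1#)         ≡⟨ solve 1 (λ x → con true :+ (con true :+ x) := x) refl _ ⟩
      T (1 ℕ.+ j ℕ.* 2) 1#                     ≡⟨ odd j ⟩
      1#                                       ∎

  -- In Horner form, the sum of y^(4^i) for i from 0 to j; at j = m it is the classical half-trace.
  halfTrace : ℕ → Carrier → Carrier
  halfTrace zero    y = y
  halfTrace (suc j) y = y + halfTrace j y ^ 4

  halfTrace-^2+ : ∀ j y → halfTrace j y ^ 2 + halfTrace j y ≡ T (2 ℕ.+ j ℕ.* 2) y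
  halfTrace-^2+ zero    y = solve 1 (λ y → y :^ 2 :+ y := y :^ 1 :+ (y :^ 2 :+ con false)) refl y
  halfTrace-^2+ (suc j) y = begin
    (y + h ^ 4) ^ 2 + (y + h ^ 4)   ≡⟨ solve 2 (λ y h → (y :+ h :^ 4) :^ 2 :+ (y :+ h :^ 4)
                                         := y :+ (y :+ (h :^ 2 :+ h) :^ 2) :^ 2) refl y h ⟩
    y + (y + (h ^ 2 + h) ^ 2) ^ 2   ≡⟨ cong (λ t → y + (y + t ^ 2) ^ 2) (halfTrace-^2+ j y) ⟩
    y + (y + T k y ^ 2) ^ 2         ≡⟨ cong (λ t → y + (y + t) ^ 2) (T-^2 k y) ⟨
    y + (y + T k (y ^ 2)) ^ 2       ≡⟨ cong (λ t → y + t ^ 2) (T-suc k y) ⟨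
    y + T (suc k) y ^ 2             ≡⟨ cong (y +_) (T-^2 (suc k) y) ⟨
    y + T (suc k) (y ^ 2)           ≡⟨ T-suc (suc k) y ⟨
    T (suc (suc k)) y               ∎
    where
    h = halfTrace j y
    k = 2 ℕ.+ j ℕ.* 2

  -- The half-trace has m + 1 terms, so b² + b collects 2m + 2 = n + 1 conjugates, one more than the
  -- trace. The extra one is y^q = y, and it alone remains.
  Tr≡0⇒∃b^2+b : ∀ {y} → Tr y ≡ 0# → ∃ λ b → b ^ 2 + b ≡ y
  Tr≡0⇒∃b^2+b {y} Tr≡0 = halfTrace m y , (begin
    halfTrace m y ^ 2 + halfTrace m y  ≡⟨ halfTrace-^2+ m y ⟩
    T (2 ℕ.+ m ℕ.* 2) y                ≡⟨ cong (λ k → T (suc k) y) n≡1+m*2 ⟨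
    T (suc n) y                        ≡⟨ T-last n y ⟩
    Tr y + y ^ q                       ≡⟨ cong₂ _+_ Tr≡0 (x^q≡x y) ⟩
    0# + y                             ≡⟨ +-identityˡ y ⟩
    y                                  ∎)

  χ≡1 : ∀ {x} → Tr x ≡ 0# → χ x ≡ 1ℤ
  χ≡1 {x} p = cong (if_then 1ℤ else -1ℤ) (dec-true (Tr x ≟ 0#) p)

  χ≡-1 : ∀ {x} → Tr x ≡ 1# → χ x ≡ -1ℤ
  χ≡-1 {x} p = cong (if_then 1ℤ else -1ℤ)
    (dec-false (Tr x ≟ 0#) λ p′ → 0≢1 (trans (sym p′) p))

  χ-+ : ∀ x y → χ (x + y) ≡ χ x ℤ.* χ y
  χ-+ x y with Tr∈01 x | Tr∈01 y
  ... | inj₁ p | inj₁ r rewrite χ≡1 p | χ≡1 r = χ≡1 (trans (Tr-+ x y) (trans (cong₂ _+_ p r) (+-identityˡ _)))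
  ... | inj₁ p | inj₂ r rewrite χ≡1 p | χ≡-1 r = χ≡-1 (trans (Tr-+ x y) (trans (cong₂ _+_ p r) (+-identityˡ _)))
  ... | inj₂ p | inj₁ r rewrite χ≡-1 p | χ≡1 r = χ≡-1 (trans (Tr-+ x y) (trans (cong₂ _+_ p r) (+-identityʳ _)))
  ... | inj₂ p | inj₂ r rewrite χ≡-1 p | χ≡-1 r = χ≡1 (trans (Tr-+ x y) (trans (cong₂ _+_ p r) (x+x≡0 _)))

  χ-^2 : ∀ x → χ (x ^ 2) ≡ χ x
  χ-^2 x with Tr∈01 x
  ... | inj₁ p = trans (χ≡1 (trans (Tr-^2 x) p)) (sym (χ≡1 p))
  ... | inj₂ p = trans (χ≡-1 (trans (Tr-^2 x) p)) (sym (χ≡-1 p))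

  -- The fibres of `g` and the set `Δ`.

  g : Carrier → Carrier
  g z = z ^ 6 + z ^ 5

  δ≡g : ∀ b → δ b ≡ g (b ^ 2 + b + 1#)
  δ≡g = solve 1 (λ b → b :^ 13 :+ (b :+ con true) :^ 13 :+ con true
    := (b :^ 2 :+ b :+ con true) :^ 6 :+ (b :^ 2 :+ b :+ con true) :^ 5) refl

  -- With p = x + y and d = x² + xy + y², g x + g y = p (p d² + d² + p² d + p⁴), so that
  -- p = 1 + e + e² for e = p² / d, and Tr (e + e²) = 0.
  g-fibre-Tr : ∀ {x y} → x ≢ y → g x ≡ g y → Tr (x + y) ≡ 1#
  g-fibre-Tr {x} {y} x≢y gx≡gy = begin
    Tr p                        ≡⟨ cong Tr p≡ ⟩
    Tr (1# + e + e ^ 2)         ≡⟨ trans (Tr-+ _ _) (cong₂ _+_ (Tr-+ _ _) (Tr-^2 e)) ⟩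
    Tr 1# + Tr e + Tr e         ≡⟨ solve 2 (λ u v → u :+ v :+ v := u) refl (Tr 1#) (Tr e) ⟩
    Tr 1#                       ≡⟨ Tr-1 ⟩
    1#                          ∎
    where
    p = x + y
    d = x ^ 2 + x * y + y ^ 2
    p≢0 : p ≢ 0#
    p≢0 = x≢y⇒x+y≢0 x≢y
    d≢0 : d ≢ 0#
    d≢0 d≡0 = x≢y (^3-injective (x+y≡0⇒x≡y (trans
      (solve 2 (λ x y → x :^ 3 :+ y :^ 3 := (x :+ y) :* (x :^ 2 :+ x :* y :+ y :^ 2)) refl x y)
      (trans (cong (p *_) d≡0) (zeroʳ p)))))
    i = proj₁ (inverse d d≢0)
    d*i≡1 : d * i ≡ 1#
    d*i≡1 = proj₂ (inverse d d≢0)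
    e = p ^ 2 * i
    relation : p * d ^ 2 + d ^ 2 + p ^ 2 * d + p ^ 4 ≡ 0#
    relation = x*y≡0⇒y≡0 p≢0 (trans
      (sym (solve 2 (λ x y → (x :^ 6 :+ x :^ 5) :+ (y :^ 6 :+ y :^ 5) :=
        let p = x :+ y ; d = x :^ 2 :+ x :* y :+ y :^ 2 in
        p :* (p :* d :^ 2 :+ d :^ 2 :+ p :^ 2 :* d :+ p :^ 4)) refl x y))
      (x≡y⇒x+y≡0 gx≡gy))
    p≡ : p ≡ 1# + e + e ^ 2
    p≡ = x+y≡0⇒x≡y (begin
      p + (1# + e + e ^ 2)
        ≡⟨ solve 2 (λ p e → p :+ (con true :+ e :+ e :^ 2)
             := p :* con true :^ 2 :+ con true :^ 2 :+ e :* con true :+ e :^ 2) refl p e ⟩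
      p * 1# ^ 2 + 1# ^ 2 + e * 1# + e ^ 2
        ≡⟨ cong (λ t → p * t ^ 2 + t ^ 2 + e * t + e ^ 2) d*i≡1 ⟨
      p * (d * i) ^ 2 + (d * i) ^ 2 + e * (d * i) + e ^ 2
        ≡⟨ solve 3 (λ p d i → p :* (d :* i) :^ 2 :+ (d :* i) :^ 2 :+ (p :^ 2 :* i) :* (d :* i) :+ (p :^ 2 :* i) :^ 2
             := (p :* d :^ 2 :+ d :^ 2 :+ p :^ 2 :* d :+ p :^ 4) :* i :^ 2) refl p d i ⟩
      (p * d ^ 2 + d ^ 2 + p ^ 2 * d + p ^ 4) * i ^ 2
        ≡⟨ trans (cong (_* i ^ 2) relation) (zeroˡ _) ⟩
      0# ∎)

  -- The ratios s = y / x of the pairs with g x = g y are parametrised by x = (1 + s⁵) / (1 + s⁶).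
  record Ratio (s x : Carrier) : Set c where
    constructor ratio
    field
      s≢1      : s ≢ 1#
      x[1+s^6] : x * (1# + s ^ 6) ≡ 1# + s ^ 5

  -- At s = 1 both sides of the defining equation vanish. The value 0 is assigned there because no
  -- genuine ratio has base 0, which keeps the map injective on the whole field.
  ratio-base : ∀ s → ∃ λ x → (s ≡ 1# × x ≡ 0#) ⊎ Ratio s x
  ratio-base s with s ≟ 1#
  ... | yes s≡1 = 0# , inj₁ (s≡1 , refl)
  ... | no s≢1 = i * (1# + s ^ 5) , inj₂ (ratio s≢1 (begin
    i * (1# + s ^ 5) * (1# + s ^ 6)    ≡⟨ solve 3 (λ a b c → a :* b :* c := b :* (c :* a)) refl i _ _ ⟩
    (1# + s ^ 5) * ((1# + s ^ 6) * i)  ≡⟨ cong ((1# + s ^ 5) *_) (proj₂ inv) ⟩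
    (1# + s ^ 5) * 1#                  ≡⟨ *-identityʳ _ ⟩
    1# + s ^ 5                         ∎))
    where
    inv = inverse (1# + s ^ 6) (x≢y⇒x+y≢0 λ p → s≢1 (^6-injective (trans (sym p) (sym (1^k≡1 6)))))
    i = proj₁ inv

  Ratio⇒x≢0 : ∀ {s x} → Ratio s x → x ≢ 0#
  Ratio⇒x≢0 {s} (ratio s≢1 eq) refl = s≢1 (s^5≡1⇒s≡1 (sym (x+y≡0⇒x≡y (trans (sym eq) (zeroˡ _)))))

  Ratio⇒g≡ : ∀ {s x} → Ratio s x → g (x * s) ≡ g x
  Ratio⇒g≡ {s} {x} (ratio _ eq) = x+y≡0⇒x≡y (begin
    g (x * s) + g x
      ≡⟨ solve 2 (λ x s → ((x :* s) :^ 6 :+ (x :* s) :^ 5) :+ (x :^ 6 :+ x :^ 5)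
           := x :^ 5 :* (x :* (con true :+ s :^ 6) :+ (con true :+ s :^ 5))) refl x s ⟩
    x ^ 5 * (x * (1# + s ^ 6) + (1# + s ^ 5))
      ≡⟨ cong (x ^ 5 *_) (x≡y⇒x+y≡0 eq) ⟩
    x ^ 5 * 0#
      ≡⟨ zeroʳ _ ⟩
    0# ∎)

  Ratio⇒xs≢x : ∀ {s x} → Ratio s x → x * s ≢ x
  Ratio⇒xs≢x r@(ratio s≢1 _) p = s≢1 (*-cancelˡ (Ratio⇒x≢0 r) (trans p (sym (*-identityʳ _))))

  -- Three distinct points in a fibre of g would have pairwise different traces.
  Ratio-unique : ∀ {s t x} → Ratio s x → Ratio t x → s ≡ t
  Ratio-unique {s} {t} {x} rs rt with x * s ≟ x * t
  ... | yes p = *-cancelˡ (Ratio⇒x≢0 rs) p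
  ... | no ¬p = ⊥-elim (0≢1 (begin
    0#                                 ≡⟨ x+x≡0 1# ⟨
    1# + 1#                            ≡⟨ cong₂ _+_ (g-fibre-Tr (Ratio⇒xs≢x rs) (Ratio⇒g≡ rs))
                                            (g-fibre-Tr (Ratio⇒xs≢x rt) (Ratio⇒g≡ rt)) ⟨
    Tr (x * s + x) + Tr (x * t + x)    ≡⟨ Tr-+ _ _ ⟨
    Tr ((x * s + x) + (x * t + x))     ≡⟨ cong Tr (solve 3 (λ a b x → (a :+ x) :+ (b :+ x) := a :+ b) refl _ _ x) ⟩
    Tr (x * s + x * t)                 ≡⟨ g-fibre-Tr ¬p (trans (Ratio⇒g≡ rs) (sym (Ratio⇒g≡ rt))) ⟩
    1#                                 ∎))

  ratio-base-injective : Injective _≡_ _≡_ (proj₁ ∘ ratio-base)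
  ratio-base-injective {s} {t} p with ratio-base s | ratio-base t
  ... | _ , inj₁ (refl , _) | _ , inj₁ (refl , _) = refl
  ... | _ , inj₁ (_ , refl) | _ , inj₂ rt = ⊥-elim (Ratio⇒x≢0 rt (sym p))
  ... | _ , inj₂ rs | _ , inj₁ (_ , refl) = ⊥-elim (Ratio⇒x≢0 rs p)
  ... | _ , inj₂ rs | _ , inj₂ rt = Ratio-unique (subst (Ratio s) p rs) rt

  -- Pigeonhole turns the uniqueness of the ratio into existence: every `x` is the base of some
  -- ratio.
  g-partner : ∀ x → ∃ λ y → y ≢ x × g y ≡ g x
  g-partner x with injective⇒surjective ratio-base-injective x
  ... | s , refl with ratio-base s
  -- The base 0 stems from the conventional value at s = 1; its partner is 1, as `g` vanishes at
  -- both.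
  ...   | _ , inj₁ (_ , refl) = 1# , 0≢1 ∘ sym , solve 0
    (con true :^ 6 :+ con true :^ 5 := con false :^ 6 :+ con false :^ 5) refl
  ...   | x , inj₂ r = x * s , Ratio⇒xs≢x r , Ratio⇒g≡ r

  -- The traces of a point and its partner differ by 1, so one of the two has the prescribed trace.
  g-preimage : ∀ {t} → t ≡ 0# ⊎ t ≡ 1# → ∀ x → ∃ λ y → Tr y ≡ t × g y ≡ g x
  g-preimage {t} t∈01 x with Tr x ≟ t
  ... | yes p = x , p , refl
  ... | no ¬p = let y , y≢x , gy≡gx = g-partner x in
    y , x+y≡0⇒x≡y (flip t∈01 (Tr∈01 x) (x+y≡z⇒x≡z+y (trans (sym (Tr-+ y x)) (g-fibre-Tr y≢x gy≡gx))) ¬p) , gy≡gx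
    where
    flip : ∀ {t u v} → t ≡ 0# ⊎ t ≡ 1# → u ≡ 0# ⊎ u ≡ 1# → v ≡ 1# + u → u ≢ t → v + t ≡ 0#
    flip (inj₁ refl) (inj₁ refl) refl u≢t = ⊥-elim (u≢t refl)
    flip (inj₁ refl) (inj₂ refl) refl u≢t = solve 0 (con true :+ con true :+ con false := con false) refl
    flip (inj₂ refl) (inj₁ refl) refl u≢t = solve 0 (con true :+ con false :+ con true := con false) refl
    flip (inj₂ refl) (inj₂ refl) refl u≢t = ⊥-elim (u≢t refl)

  -- Within the fibre choose `z` of trace 1. Then z + 1 has trace 0, hence is of the form b² + b,
  -- and `g z` is `δ b`.
  g∈Δ : ∀ x → g x ∈ Δ
  g∈Δ x = let
      z , Tr[z]≡1 , gz≡gx = g-preimage (inj₂ refl) x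
      b , b^2+b≡z+1 = Tr≡0⇒∃b^2+b (trans (Tr-+ z 1#) (trans (cong₂ _+_ Tr[z]≡1 Tr-1) (x+x≡0 1#)))
    in subst (_∈ Δ) (begin
      δ b                        ≡⟨ δ≡g b ⟩
      g (b ^ 2 + b + 1#)         ≡⟨ cong (λ t → g (t + 1#)) b^2+b≡z+1 ⟩
      g (z + 1# + 1#)            ≡⟨ cong g (solve 1 (λ z → z :+ con true :+ con true := z) refl z) ⟩
      g z                        ≡⟨ gz≡gx ⟩
      g x                        ∎)
    (∈-deduplicate⁺ _≟_ (∈-map⁺ δ (∈-elements b)))

  -- A level set of the trace is a system of representatives for the fibres of g.
  map-g-↭-Δ : ∀ {p} {P : Pred Carrier p} (P? : Decidable P) →
    (∀ x → ∃ λ y → P y × g y ≡ g x) → (∀ {x y} → P x → P y → Tr x ≡ Tr y) →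
    map g (filter P? elements) ↭ Δ
  map-g-↭-Δ P? P-preimage P-Tr = unique∧set⇒↭
    (map-unique g inj (Unique.filter⁺ P? elements-unique))
    (DecUnique.deduplicate-! _≟_ _)
    (λ t∈ → let x , _ , t≡gx = ∈-map⁻ g t∈ in subst (_∈ Δ) (sym t≡gx) (g∈Δ x))
    (λ t∈ → let
        b , _ , t≡δb = ∈-map⁻ δ (∈-deduplicate⁻ _≟_ (map δ elements) t∈)
        y , Py , gy≡ = P-preimage (b ^ 2 + b + 1#)
      in subst (_∈ _) (trans gy≡ (sym (trans t≡δb (δ≡g b)))) (∈-map⁺ g (∈-filter⁺ P? (∈-elements y) Py)))
    where
    inj : ∀ {x y} → x ∈ filter P? elements → y ∈ filter P? elements → g x ≡ g y → x ≡ y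
    inj {x} {y} x∈ y∈ gx≡gy with x ≟ y
    ... | yes p = p
    ... | no x≢y = ⊥-elim (0≢1 (trans
      (sym (x≡y⇒x+y≡0 (P-Tr (proj₂ (∈-filter⁻ P? {xs = elements} x∈)) (proj₂ (∈-filter⁻ P? {xs = elements} y∈)))))
      (trans (sym (Tr-+ x y)) (g-fibre-Tr x≢y gx≡gy))))

  module ∑ = Fold {A = Carrier} ℤ.+-0-isCommutativeMonoid

  -- The two level sets of the trace partition the field, and `g` maps each of them bijectively onto
  -- `Δ`.
  S+S≡ : ∀ x → S x ℤ.+ S x ≡ ∑[ elements ] λ z → χ (x * g z)
  S+S≡ x = sym (begin
    ∑[ elements ] (f ∘ g)
      ≡⟨ ∑.⨀-filter P? elements (f ∘ g) ⟩
    ∑[ filter P? elements ] (f ∘ g) ℤ.+ ∑[ filter (¬? ∘ P?) elements ] (f ∘ g)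
      ≡⟨ cong₂ ℤ._+_ (through-g (map-g-↭-Δ P? (g-preimage (inj₁ refl)) λ p q → trans p (sym q)))
           (through-g (map-g-↭-Δ (¬? ∘ P?) preimage₁ λ p q → trans (≢0⇒≡1 p) (sym (≢0⇒≡1 q)))) ⟩
    S x ℤ.+ S x ∎)
    where
    f = λ t → χ (x * t)
    P? = λ z → Tr z ≟ 0#
    ≢0⇒≡1 : ∀ {z} → Tr z ≢ 0# → Tr z ≡ 1#
    ≢0⇒≡1 {z} ¬p with Tr∈01 z
    ... | inj₁ p = ⊥-elim (¬p p)
    ... | inj₂ p = p
    preimage₁ : ∀ z → ∃ λ y → Tr y ≢ 0# × g y ≡ g z
    preimage₁ z = let y , p , q = g-preimage (inj₂ refl) z in y , (λ r → 0≢1 (trans (sym r) p)) , q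
    through-g : ∀ {xs} → map g xs ↭ Δ → ∑[ xs ] (f ∘ g) ≡ S x
    through-g {xs} p = trans (sym (∑.⨀-map xs f g)) (∑.⨀-↭ f p)

open import Data.Integer.Base using (+_)

-- Complete character sums and orthogonality.

module CubicMoment {c} (n m : ℕ) (n≡1+m*2 : n ≡ suc (m ℕ.* 2)) (K : FiniteField c (2 ℕ.^ n)) where

  open FiniteField K
  open FieldProperties K
  open OddDegree n m n≡1+m*2 K
  open Kasami n K
  open Solver using (solve; con; _:+_; _:*_; _:^_; _:=_)
  open ≡-Reasoning

  Σ : (Carrier → ℤ) → ℤ
  Σ = ∑[ elements ]

  nonzero : List Carrier
  nonzero = others 0#

  ∑-*ˡ : ∀ k xs f → k ℤ.* ∑[ xs ] f ≡ ∑[ xs ] (λ x → k ℤ.* f x)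
  ∑-*ˡ k []       f = ℤ.*-zeroʳ k
  ∑-*ˡ k (x ∷ xs) f = trans (ℤ.*-distribˡ-+ k (f x) _) (cong (ℤ._+_ (k ℤ.* f x)) (∑-*ˡ k xs f))

  ∑-*ʳ : ∀ k xs f → ∑[ xs ] f ℤ.* k ≡ ∑[ xs ] (λ x → f x ℤ.* k)
  ∑-*ʳ k xs f = trans (ℤ.*-comm _ k) (trans (∑-*ˡ k xs f) (∑.⨀-cong xs λ x → ℤ.*-comm k (f x)))

  ∑-if : ∀ {p} {P : Pred Carrier p} (P? : Decidable P) k xs →
    ∑[ xs ] (λ x → if does (P? x) then k else 0ℤ) ≡ k ℤ.* (+ length (filter P? xs))
  ∑-if P? k []       = sym (ℤ.*-zeroʳ k)
  ∑-if P? k (x ∷ xs) with does (P? x)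
  ... | true  = trans (cong (ℤ._+_ k) (∑-if P? k xs)) (sym (ℤ.*-suc k (+ length (filter P? xs))))
  ... | false = trans (ℤ.+-identityˡ _) (∑-if P? k xs)

  Σ-const : ∀ k → Σ (λ _ → k) ≡ + q ℤ.* k
  Σ-const k = trans (const elements) (cong (λ l → + l ℤ.* k) length-elements)
    where
    const : ∀ xs → ∑[ xs ] (λ _ → k) ≡ + length xs ℤ.* k
    const []       = sym (ℤ.*-zeroˡ k)
    const (x ∷ xs) = trans (cong (ℤ._+_ k) (const xs)) (sym (ℤ.suc-* (+ length xs) k))

  Σ-reindex : ∀ {f : Carrier → Carrier} → Injective _≡_ _≡_ f → ∀ h → Σ (h ∘ f) ≡ Σ h
  Σ-reindex f-inj h = trans (sym (∑.⨀-map elements h _)) (∑.⨀-↭ h (map-elements-↭ f-inj))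

  Σ-split : ∀ x₀ h → Σ h ≡ h x₀ ℤ.+ ∑[ others x₀ ] h
  Σ-split x₀ h = ∑.⨀-↭ h (elements-↭-∷ x₀)

  Σ-support : ∀ x₀ h → (∀ {x} → x ≢ x₀ → h x ≡ 0ℤ) → Σ h ≡ h x₀
  Σ-support x₀ h h≡0 = begin
    Σ h                                  ≡⟨ Σ-split x₀ h ⟩
    h x₀ ℤ.+ ∑[ others x₀ ] h            ≡⟨ cong (ℤ._+_ (h x₀)) (∑.⨀-cong-∈ {others x₀} λ x∈ → h≡0 (∈-others x∈)) ⟩
    h x₀ ℤ.+ ∑[ others x₀ ] (λ _ → 0ℤ)   ≡⟨ cong (ℤ._+_ (h x₀)) (∑.⨀-ε (others x₀)) ⟩
    h x₀ ℤ.+ 0ℤ                          ≡⟨ ℤ.+-identityʳ _ ⟩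
    h x₀                                 ∎

  -- The shift by `1#` permutes the field and, as its trace is 1, flips every sign.
  Σχ≡0 : Σ χ ≡ 0ℤ
  Σχ≡0 = self-negative (begin
    Σ χ                        ≡⟨ Σ-reindex +1-injective χ ⟨
    Σ (λ x → χ (x + 1#))       ≡⟨ ∑.⨀-cong elements (λ x → trans (χ-+ x 1#) (cong (χ x ℤ.*_) (χ≡-1 Tr-1))) ⟩
    Σ (λ x → χ x ℤ.* -1ℤ)      ≡⟨ ∑-*ʳ -1ℤ elements χ ⟨
    Σ χ ℤ.* -1ℤ                ≡⟨ ℤ.*-comm (Σ χ) -1ℤ ⟩
    -1ℤ ℤ.* Σ χ                ≡⟨ ℤ.-1*i≡-i (Σ χ) ⟩
    ℤ.- Σ χ                    ∎)
    where
    +1-injective : Injective _≡_ _≡_ (_+ 1#)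
    +1-injective = +-cancelʳ 1# _ _
    self-negative : ∀ {i} → i ≡ ℤ.- i → i ≡ 0ℤ
    self-negative {+ zero}     _ = refl

  -- The orthogonality kernel: the value of the complete sum of χ(xc) over x.
  J : Carrier → ℤ
  J c = if does (c ≟ 0#) then + q else 0ℤ

  J≡q : ∀ {c} → c ≡ 0# → J c ≡ + q
  J≡q {c} p = cong (if_then + q else 0ℤ) (dec-true (c ≟ 0#) p)

  J≡0 : ∀ {c} → c ≢ 0# → J c ≡ 0ℤ
  J≡0 {c} ¬p = cong (if_then + q else 0ℤ) (dec-false (c ≟ 0#) ¬p)

  Σχ[x*c]≡J : ∀ c → Σ (λ x → χ (x * c)) ≡ J c
  Σχ[x*c]≡J c = trans (∑.⨀-cong elements λ x → cong χ (*-comm x c)) (lemma c)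
    where
    lemma : ∀ c → Σ (λ x → χ (c * x)) ≡ J c
    lemma c with c ≟ 0#
    ... | no c≢0 = trans (Σ-reindex (*-injective c≢0) χ) (trans Σχ≡0 (sym (J≡0 c≢0)))
    ... | yes refl = trans (∑.⨀-cong elements λ x → trans (cong χ (zeroˡ x)) (χ≡1 Tr-0))
      (trans (Σ-const 1ℤ) (trans (ℤ.*-identityʳ _) (sym (J≡q refl))))

  Σχ[x^3*c]≡J : ∀ c → Σ (λ x → χ (x ^ 3 * c)) ≡ J c
  Σχ[x^3*c]≡J c = trans (Σ-reindex ^3-injective (λ x → χ (x * c))) (Σχ[x*c]≡J c)

  -- The missing term at y = 0 equals 1. Summed over τ, this is the origin of the -1 next to
  -- `r a b`.
  ∑χ[y^3*c]≡J-1 : ∀ c → ∑[ nonzero ] (λ y → χ (y ^ 3 * c)) ≡ J c ℤ.+ -1ℤ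
  ∑χ[y^3*c]≡J-1 c = begin
    s                            ≡⟨ cancel s ⟩
    1ℤ ℤ.+ s ℤ.+ -1ℤ             ≡⟨ cong (λ t → t ℤ.+ s ℤ.+ -1ℤ) (χ≡1 (trans (cong Tr zero-term) Tr-0)) ⟨
    χ (0# ^ 3 * c) ℤ.+ s ℤ.+ -1ℤ ≡⟨ cong (ℤ._+ -1ℤ) (Σ-split 0# (λ y → χ (y ^ 3 * c))) ⟨
    Σ (λ y → χ (y ^ 3 * c)) ℤ.+ -1ℤ ≡⟨ cong (ℤ._+ -1ℤ) (Σχ[x^3*c]≡J c) ⟩
    J c ℤ.+ -1ℤ                  ∎
    where
    s = ∑[ nonzero ] (λ y → χ (y ^ 3 * c))
    zero-term : 0# ^ 3 * c ≡ 0#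
    zero-term = solve 1 (λ c → con false :^ 3 :* c := con false) refl c
    cancel : ∀ s → s ≡ 1ℤ ℤ.+ s ℤ.+ -1ℤ
    cancel = solve-∀

  G : Carrier → ℤ
  G μ = Σ λ x → χ (x ^ 3 + μ * x ^ 5)

  S+S≡G : ∀ {μ} → μ ≢ 0# → S (μ ^ 6) ℤ.+ S (μ ^ 6) ≡ G μ
  S+S≡G {μ} μ≢0 = begin
    S (μ ^ 6) ℤ.+ S (μ ^ 6)                              ≡⟨ S+S≡ (μ ^ 6) ⟩
    Σ (λ z → χ (μ ^ 6 * g z))                            ≡⟨ ∑.⨀-cong elements term ⟩
    Σ (λ z → χ ((μ * z) ^ 3 + μ * (μ * z) ^ 5))          ≡⟨ Σ-reindex (*-injective μ≢0) (λ x → χ (x ^ 3 + μ * x ^ 5)) ⟩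
    G μ                                                  ∎
    where
    term : ∀ z → χ (μ ^ 6 * g z) ≡ χ ((μ * z) ^ 3 + μ * (μ * z) ^ 5)
    term z = begin
      χ (μ ^ 6 * g z)                                    ≡⟨ cong χ (solve 2 (λ μ z → μ :^ 6 :* (z :^ 6 :+ z :^ 5)
                                                              := ((μ :* z) :^ 3) :^ 2 :+ μ :* (μ :* z) :^ 5) refl μ z) ⟩
      χ (((μ * z) ^ 3) ^ 2 + μ * (μ * z) ^ 5)            ≡⟨ χ-+ _ _ ⟩
      χ (((μ * z) ^ 3) ^ 2) ℤ.* χ (μ * (μ * z) ^ 5)      ≡⟨ cong (ℤ._* χ (μ * (μ * z) ^ 5)) (χ-^2 _) ⟩
      χ ((μ * z) ^ 3) ℤ.* χ (μ * (μ * z) ^ 5)            ≡⟨ χ-+ _ _ ⟨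
      χ ((μ * z) ^ 3 + μ * (μ * z) ^ 5)                  ∎

  G-0 : G 0# ≡ 0ℤ
  G-0 = trans (∑.⨀-cong elements λ x → cong χ (solve 1 (λ x → x :^ 3 :+ con false :* x :^ 5 := x :^ 3) refl x))
    (trans (Σ-reindex ^3-injective χ) Σχ≡0)

  -- From `Z` to a triple product of the sums `G`.

  module _ {a b : Carrier} (a≢0 : a ≢ 0#) (b≢0 : b ≢ 0#) where

    -- With λ = μ⁶ the three arguments of `S` are the sixth powers of μ, μa and μb, all nonzero;
    -- each factor absorbs one of the three twos in 8.
    8Z≡ΣGGG : ∀ {ρ} → a ^ 6 ≡ ρ → b ^ 6 ≡ 1# + ρ →
      + 8 ℤ.* Z ρ ≡ Σ (λ μ → G μ ℤ.* G (μ * a) ℤ.* G (μ * b))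
    8Z≡ΣGGG {ρ} refl b^6≡ = begin
      + 8 ℤ.* Z ρ
        ≡⟨ cong (+ 8 ℤ.*_) (∑.⨀-↭ SSS (map-others-↭ ^6-injective 0# (zeroˡ _))) ⟨
      + 8 ℤ.* ∑[ map (_^ 6) nonzero ] SSS
        ≡⟨ cong (+ 8 ℤ.*_) (∑.⨀-map nonzero SSS (_^ 6)) ⟩
      + 8 ℤ.* ∑[ nonzero ] (SSS ∘ (_^ 6))
        ≡⟨ ∑-*ˡ (+ 8) nonzero _ ⟩
      ∑[ nonzero ] (λ μ → + 8 ℤ.* SSS (μ ^ 6))
        ≡⟨ ∑.⨀-cong-∈ {nonzero} (λ μ∈ → term (∈-others μ∈)) ⟩
      ∑[ nonzero ] GGG
        ≡⟨ ℤ.+-identityˡ _ ⟨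
      0ℤ ℤ.+ ∑[ nonzero ] GGG
        -- The term at μ = 0 vanishes, so it may be added; orthogonality needs μ to range over the
        -- whole field.
        ≡⟨ cong (ℤ._+ ∑[ nonzero ] GGG) (cong (λ t → t ℤ.* G (0# * a) ℤ.* G (0# * b)) G-0) ⟨
      GGG 0# ℤ.+ ∑[ nonzero ] GGG
        ≡⟨ Σ-split 0# GGG ⟨
      Σ GGG ∎
      where
      SSS GGG : Carrier → ℤ
      SSS x = S x ℤ.* S (x * ρ) ℤ.* S (x * (1# + ρ))
      GGG μ = G μ ℤ.* G (μ * a) ℤ.* G (μ * b)
      double³ : ∀ u v w → + 8 ℤ.* (u ℤ.* v ℤ.* w) ≡ (u ℤ.+ u) ℤ.* (v ℤ.+ v) ℤ.* (w ℤ.+ w)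
      double³ = solve-∀
      term : ∀ {μ} → μ ≢ 0# → + 8 ℤ.* SSS (μ ^ 6) ≡ GGG μ
      term {μ} μ≢0 = trans (cong₂ (λ x y → + 8 ℤ.* (S (μ ^ 6) ℤ.* S x ℤ.* S y))
          (sym (^-distrib-* μ a 6)) (trans (cong (μ ^ 6 *_) (sym b^6≡)) (sym (^-distrib-* μ b 6))))
        (trans (double³ (S (μ ^ 6)) (S ((μ * a) ^ 6)) (S ((μ * b) ^ 6)))
          (cong₂ ℤ._*_ (cong₂ ℤ._*_ (S+S≡G μ≢0) (S+S≡G (x*y≢0 μ≢0 a≢0))) (S+S≡G (x*y≢0 μ≢0 b≢0))))

  -- The double character sum and the curve equation.

  ⁵√_ : Carrier → Carrier
  ⁵√ x = proj₁ (injective⇒surjective ^5-injective x)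

  [⁵√x]^5≡x : ∀ x → (⁵√ x) ^ 5 ≡ x
  [⁵√x]^5≡x x = proj₂ (injective⇒surjective ^5-injective x)

  ⁵√-unique : ∀ {x y} → y ^ 5 ≡ x → ⁵√ x ≡ y
  ⁵√-unique p = ^5-injective (trans ([⁵√x]^5≡x _) (sym p))

  module _ (a b : Carrier) where

    -- The summand that remains once `z` is eliminated as the only fifth root of a x⁵ + b y⁵.
    E : Carrier → Carrier → ℤ
    E x y = χ (x ^ 3 + y ^ 3 + (⁵√ (a * x ^ 5 + b * y ^ 5)) ^ 3)

    ΣGGG≡qΣΣE : Σ (λ μ → G μ ℤ.* G (μ * a) ℤ.* G (μ * b)) ≡ + q ℤ.* Σ (λ x → Σ (λ y → E x y))
    ΣGGG≡qΣΣE = begin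
      Σ (λ μ → G μ ℤ.* G (μ * a) ℤ.* G (μ * b))
        ≡⟨ ∑.⨀-cong elements expand ⟩
      Σ (λ μ → Σ λ x → Σ λ y → Σ λ z → t μ x y z)
        -- Three exchanges carry the sum over `μ` past `x`, `y` and `z` to the innermost place.
        ≡⟨ ∑.⨀-swap elements elements (λ μ x → Σ λ y → Σ λ z → t μ x y z) ⟩
      Σ (λ x → Σ λ μ → Σ λ y → Σ λ z → t μ x y z)
        ≡⟨ (∑.⨀-cong elements λ x → ∑.⨀-swap elements elements λ μ y → Σ λ z → t μ x y z) ⟩
      Σ (λ x → Σ λ y → Σ λ μ → Σ λ z → t μ x y z)
        ≡⟨ (∑.⨀-cong elements λ x → ∑.⨀-cong elements λ y → ∑.⨀-swap elements elements λ μ z → t μ x y z) ⟩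
      Σ (λ x → Σ λ y → Σ λ z → Σ λ μ → t μ x y z)
        ≡⟨ (∑.⨀-cong elements λ x → ∑.⨀-cong elements λ y → ∑.⨀-cong elements λ z → Σμ x y z) ⟩
      Σ (λ x → Σ λ y → Σ λ z → χ (x ^ 3 + y ^ 3 + z ^ 3) ℤ.* J (a * x ^ 5 + b * y ^ 5 + z ^ 5))
        ≡⟨ (∑.⨀-cong elements λ x → ∑.⨀-cong elements λ y → Σz x y) ⟩
      Σ (λ x → Σ λ y → + q ℤ.* E x y)
        ≡⟨ (∑.⨀-cong elements λ x → ∑-*ˡ (+ q) elements (E x)) ⟨
      Σ (λ x → + q ℤ.* Σ (λ y → E x y))
        ≡⟨ ∑-*ˡ (+ q) elements (λ x → Σ (λ y → E x y)) ⟨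
      + q ℤ.* Σ (λ x → Σ (λ y → E x y)) ∎
      where
      φ : Carrier → Carrier → ℤ
      φ μ x = χ (x ^ 3 + μ * x ^ 5)
      t : Carrier → Carrier → Carrier → Carrier → ℤ
      t μ x y z = φ μ z ℤ.* φ (μ * a) x ℤ.* φ (μ * b) y
      expand : ∀ μ → G μ ℤ.* G (μ * a) ℤ.* G (μ * b) ≡ Σ λ x → Σ λ y → Σ λ z → t μ x y z
      expand μ = begin
        G μ ℤ.* G (μ * a) ℤ.* G (μ * b)
          ≡⟨ cong (ℤ._* G (μ * b)) (∑-*ˡ (G μ) elements (φ (μ * a))) ⟩
        Σ (λ x → G μ ℤ.* φ (μ * a) x) ℤ.* G (μ * b)
          ≡⟨ ∑-*ʳ (G (μ * b)) elements _ ⟩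
        Σ (λ x → G μ ℤ.* φ (μ * a) x ℤ.* G (μ * b))
          ≡⟨ (∑.⨀-cong elements λ x → trans (∑-*ˡ (G μ ℤ.* φ (μ * a) x) elements (φ (μ * b)))
               (∑.⨀-cong elements λ y → trans
                 (cong (ℤ._* φ (μ * b) y) (∑-*ʳ (φ (μ * a) x) elements (φ μ)))
                 (∑-*ʳ (φ (μ * b) y) elements (λ z → φ μ z ℤ.* φ (μ * a) x)))) ⟩
        (Σ λ x → Σ λ y → Σ λ z → t μ x y z) ∎
      Σμ : ∀ x y z → Σ (λ μ → t μ x y z) ≡ χ (x ^ 3 + y ^ 3 + z ^ 3) ℤ.* J (a * x ^ 5 + b * y ^ 5 + z ^ 5)
      Σμ x y z = begin
        Σ (λ μ → t μ x y z)
          ≡⟨ (∑.⨀-cong elements λ μ → trans (sym (trans (χ-+ _ _) (cong (ℤ._* φ (μ * b) y) (χ-+ _ _))))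
               (trans (cong χ (solve 6 (λ x y z a b μ →
                 z :^ 3 :+ μ :* z :^ 5 :+ (x :^ 3 :+ μ :* a :* x :^ 5) :+ (y :^ 3 :+ μ :* b :* y :^ 5)
                 := (x :^ 3 :+ y :^ 3 :+ z :^ 3) :+ μ :* (a :* x :^ 5 :+ b :* y :^ 5 :+ z :^ 5)) refl x y z a b μ))
               (χ-+ _ _))) ⟩
        Σ (λ μ → χ (x ^ 3 + y ^ 3 + z ^ 3) ℤ.* χ (μ * (a * x ^ 5 + b * y ^ 5 + z ^ 5)))
          ≡⟨ ∑-*ˡ (χ (x ^ 3 + y ^ 3 + z ^ 3)) elements _ ⟨
        χ (x ^ 3 + y ^ 3 + z ^ 3) ℤ.* Σ (λ μ → χ (μ * (a * x ^ 5 + b * y ^ 5 + z ^ 5)))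
          ≡⟨ cong (χ (x ^ 3 + y ^ 3 + z ^ 3) ℤ.*_) (Σχ[x*c]≡J _) ⟩
        χ (x ^ 3 + y ^ 3 + z ^ 3) ℤ.* J (a * x ^ 5 + b * y ^ 5 + z ^ 5) ∎
      Σz : ∀ x y → Σ (λ z → χ (x ^ 3 + y ^ 3 + z ^ 3) ℤ.* J (a * x ^ 5 + b * y ^ 5 + z ^ 5)) ≡ + q ℤ.* E x y
      Σz x y = begin
        Σ h                      ≡⟨ Σ-support (⁵√ w) h h≡0 ⟩
        h (⁵√ w)                 ≡⟨ cong (E x y ℤ.*_) (J≡q (x≡y⇒x+y≡0 (sym ([⁵√x]^5≡x w)))) ⟩
        E x y ℤ.* + q            ≡⟨ ℤ.*-comm (E x y) (+ q) ⟩
        + q ℤ.* E x y            ∎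
        where
        w = a * x ^ 5 + b * y ^ 5
        h : Carrier → ℤ
        h z = χ (x ^ 3 + y ^ 3 + z ^ 3) ℤ.* J (w + z ^ 5)
        h≡0 : ∀ {z} → z ≢ ⁵√ w → h z ≡ 0ℤ
        h≡0 {z} z≢ = trans
          (cong (χ (x ^ 3 + y ^ 3 + z ^ 3) ℤ.*_)
            (J≡0 λ p → z≢ (sym (⁵√-unique (sym (x+y≡0⇒x≡y p))))))
          (ℤ.*-zeroʳ (χ (x ^ 3 + y ^ 3 + z ^ 3)))

    -- The argument of `χ` in `E` at the point (τ, 1).
    w : Carrier → Carrier
    w τ = τ ^ 3 + 1# + (⁵√ (a * τ ^ 5 + b)) ^ 3

    -- At y = 0 the fifth root is linear in `x`, equal to αx with α⁵ = a, so the sum vanishes unless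
    -- α³ = 1; that would force α = 1 and a = 1.
    ΣE[x,0]≡0 : a ≢ 1# → Σ (λ x → E x 0#) ≡ 0ℤ
    ΣE[x,0]≡0 a≢1 = begin
      Σ (λ x → E x 0#)                       ≡⟨ (∑.⨀-cong elements λ x → cong χ (term x)) ⟩
      Σ (λ x → χ (x ^ 3 * (1# + α ^ 3)))     ≡⟨ Σχ[x^3*c]≡J _ ⟩
      J (1# + α ^ 3)                         ≡⟨ J≡0 (x≢y⇒x+y≢0 1≢α^3) ⟩
      0ℤ                                     ∎
      where
      α = ⁵√ a
      1≢α^3 : 1# ≢ α ^ 3
      1≢α^3 p = a≢1 (trans (sym ([⁵√x]^5≡x a)) (trans (cong (_^ 5) (s^3≡1⇒s≡1 (sym p))) (1^k≡1 5)))
      term : ∀ x → x ^ 3 + 0# ^ 3 + (⁵√ (a * x ^ 5 + b * 0# ^ 5)) ^ 3 ≡ x ^ 3 * (1# + α ^ 3)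
      term x = begin
        x ^ 3 + 0# ^ 3 + (⁵√ (a * x ^ 5 + b * 0# ^ 5)) ^ 3  ≡⟨ cong (λ t → x ^ 3 + 0# ^ 3 + t ^ 3) (⁵√-unique root) ⟩
        x ^ 3 + 0# ^ 3 + (α * x) ^ 3                        ≡⟨ solve 2 (λ x α → x :^ 3 :+ con false :^ 3 :+ (α :* x) :^ 3
                                                                 := x :^ 3 :* (con true :+ α :^ 3)) refl x α ⟩
        x ^ 3 * (1# + α ^ 3)                                ∎
        where
        root : (α * x) ^ 5 ≡ a * x ^ 5 + b * 0# ^ 5
        root = trans (^-distrib-* α x 5) (trans (cong (_* x ^ 5) ([⁵√x]^5≡x a))
          (solve 3 (λ a b x → a :* x :^ 5 := a :* x :^ 5 :+ b :* con false :^ 5) refl a b x))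

    -- Homogeneity: scaling both variables by `y` scales the fifth root by `y`, hence the argument
    -- of `χ` by y³.
    ΣE[x,y]≡Σχ : ∀ {y} → y ≢ 0# → Σ (λ x → E x y) ≡ Σ (λ τ → χ (y ^ 3 * w τ))
    ΣE[x,y]≡Σχ {y} y≢0 = trans (sym (Σ-reindex (*-injective y≢0) (λ x → E x y)))
      (∑.⨀-cong elements λ τ → cong χ (begin
        (y * τ) ^ 3 + y ^ 3 + (⁵√ (a * (y * τ) ^ 5 + b * y ^ 5)) ^ 3
          ≡⟨ cong (λ t → (y * τ) ^ 3 + y ^ 3 + t ^ 3) (⁵√-unique (root τ)) ⟩
        (y * τ) ^ 3 + y ^ 3 + (y * ⁵√ (a * τ ^ 5 + b)) ^ 3
          ≡⟨ solve 3 (λ y τ s → (y :* τ) :^ 3 :+ y :^ 3 :+ (y :* s) :^ 3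
               := y :^ 3 :* (τ :^ 3 :+ con true :+ s :^ 3)) refl y τ _ ⟩
        y ^ 3 * w τ ∎))
      where
      root : ∀ τ → (y * ⁵√ (a * τ ^ 5 + b)) ^ 5 ≡ a * (y * τ) ^ 5 + b * y ^ 5
      root τ = trans (^-distrib-* y _ 5) (trans (cong (y ^ 5 *_) ([⁵√x]^5≡x _))
        (solve 4 (λ y τ a b → y :^ 5 :* (a :* τ :^ 5 :+ b) := a :* (y :* τ) :^ 5 :+ b :* y :^ 5) refl y τ a b))

    -- Fifth powers are injective, so raising ζ³ = τ³ + 1 to the fifth power loses nothing and
    -- removes the root, as ζ⁵ = a τ⁵ + b.
    J[w]≡ : ∀ τ → J (w τ) ≡ (if does ((a * τ ^ 5 + b) ^ 3 ≟ (τ ^ 3 + 1#) ^ 5) then + q else 0ℤ)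
    J[w]≡ τ = by-cases (w τ ≟ 0#)
      where
      P? = (a * τ ^ 5 + b) ^ 3 ≟ (τ ^ 3 + 1#) ^ 5
      ζ = ⁵√ (a * τ ^ 5 + b)
      [ζ^3]^5≡ : (ζ ^ 3) ^ 5 ≡ (a * τ ^ 5 + b) ^ 3
      [ζ^3]^5≡ = trans (^-assocʳ ζ 3 5) (trans (sym (^-assocʳ ζ 5 3)) (cong (_^ 3) ([⁵√x]^5≡x _)))
      by-cases : Dec (w τ ≡ 0#) → J (w τ) ≡ (if does P? then + q else 0ℤ)
      by-cases (yes w≡0) = trans (J≡q w≡0) (sym (cong (if_then + q else 0ℤ) (dec-true P?
        (trans (sym [ζ^3]^5≡) (cong (_^ 5) (sym (x+y≡0⇒x≡y w≡0)))))))
      by-cases (no w≢0) = trans (J≡0 w≢0) (sym (cong (if_then + q else 0ℤ) (dec-false P?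
        λ p → w≢0 (x≡y⇒x+y≡0 (^5-injective (trans (sym p) (sym [ζ^3]^5≡)))))))

    ΣΣE≡ : a ≢ 1# → Σ (λ x → Σ (λ y → E x y)) ≡ + q ℤ.* (+ r a b ℤ.- 1ℤ)
    ΣΣE≡ a≢1 = begin
      Σ (λ x → Σ (λ y → E x y))
        ≡⟨ ∑.⨀-swap elements elements E ⟩
      Σ (λ y → Σ (λ x → E x y))
        ≡⟨ Σ-split 0# (λ y → Σ (λ x → E x y)) ⟩
      Σ (λ x → E x 0#) ℤ.+ ∑[ nonzero ] (λ y → Σ (λ x → E x y))
        ≡⟨ cong₂ ℤ._+_ (ΣE[x,0]≡0 a≢1) (∑.⨀-cong-∈ {nonzero} λ y∈ → ΣE[x,y]≡Σχ (∈-others y∈)) ⟩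
      0ℤ ℤ.+ ∑[ nonzero ] (λ y → Σ (λ τ → χ (y ^ 3 * w τ)))
        ≡⟨ ℤ.+-identityˡ _ ⟩
      ∑[ nonzero ] (λ y → Σ (λ τ → χ (y ^ 3 * w τ)))
        ≡⟨ ∑.⨀-swap nonzero elements (λ y τ → χ (y ^ 3 * w τ)) ⟩
      Σ (λ τ → ∑[ nonzero ] (λ y → χ (y ^ 3 * w τ)))
        ≡⟨ (∑.⨀-cong elements λ τ → ∑χ[y^3*c]≡J-1 (w τ)) ⟩
      Σ (λ τ → J (w τ) ℤ.+ -1ℤ)
        ≡⟨ ∑.⨀-∙ elements (J ∘ w) (λ _ → -1ℤ) ⟩
      Σ (J ∘ w) ℤ.+ Σ (λ _ → -1ℤ)
        ≡⟨ cong₂ ℤ._+_ (trans (∑.⨀-cong elements J[w]≡)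
             (∑-if (λ τ → (a * τ ^ 5 + b) ^ 3 ≟ (τ ^ 3 + 1#) ^ 5) (+ q) elements)) (Σ-const -1ℤ) ⟩
      + q ℤ.* + r a b ℤ.+ + q ℤ.* -1ℤ
        ≡⟨ ℤ.*-distribˡ-+ (+ q) (+ r a b) -1ℤ ⟨
      + q ℤ.* (+ r a b ℤ.- 1ℤ) ∎

  -- The subtraction is truncated, so 2n must be at least 3. An element other than 0 and 1 excludes
  -- n = 1, where every element satisfies ρ² = ρ.
  8*2^[2n∸3]≡q*q : ∀ {ρ} → ≢0,1 ρ → 8 ℕ.* 2 ℕ.^ (2 ℕ.* n ∸ 3) ≡ q ℕ.* q
  8*2^[2n∸3]≡q*q {ρ} (ρ≢0 , ρ≢1) = begin
    2 ℕ.^ 3 ℕ.* 2 ℕ.^ (2 ℕ.* n ∸ 3)    ≡⟨ ℕ.^-distribˡ-+-* 2 3 (2 ℕ.* n ∸ 3) ⟨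
    2 ℕ.^ (3 ℕ.+ (2 ℕ.* n ∸ 3))        ≡⟨ cong (2 ℕ.^_) (ℕ.m+[n∸m]≡n 3≤2n) ⟩
    2 ℕ.^ (2 ℕ.* n)                    ≡⟨ cong (λ k → 2 ℕ.^ (n ℕ.+ k)) (ℕ.+-identityʳ n) ⟩
    2 ℕ.^ (n ℕ.+ n)                    ≡⟨ ℕ.^-distribˡ-+-* 2 n n ⟩
    q ℕ.* q                            ∎
    where
    m≢0 : m ≢ 0
    m≢0 m≡0 with x^2≡x⇒x∈01 (subst (λ k → ρ ^ (2 ℕ.^ k) ≡ ρ)
      (trans n≡1+m*2 (cong (λ k → suc (k ℕ.* 2)) m≡0)) (x^q≡x ρ))
    ... | inj₁ ρ≡0 = ρ≢0 ρ≡0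
    ... | inj₂ ρ≡1 = ρ≢1 ρ≡1
    3≤n : 3 ℕ.≤ n
    3≤n = subst (3 ℕ.≤_) (sym n≡1+m*2) (ℕ.s≤s (ℕ.*-monoˡ-≤ 2 (ℕ.n≢0⇒n>0 m≢0)))
    3≤2n : 3 ℕ.≤ 2 ℕ.* n
    3≤2n = ℕ.≤-trans 3≤n (ℕ.m≤n*m n 2)

  Z≡ : ∀ {ρ a b} → ≢0,1 ρ → a ^ 6 ≡ ρ → b ^ 6 ≡ 1# + ρ →
    Z ρ ≡ (+ (2 ℕ.^ (2 ℕ.* n ∸ 3))) ℤ.* ((+ r a b) ℤ.- 1ℤ)
  Z≡ {ρ} {a} {b} ρ≢0,1@(ρ≢0 , ρ≢1) a^6≡ b^6≡ =
    ℤ.*-cancelˡ-≡ (+ 8) (Z ρ) (+ (2 ℕ.^ (2 ℕ.* n ∸ 3)) ℤ.* (+ r a b ℤ.- 1ℤ)) (begin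
    + 8 ℤ.* Z ρ
      ≡⟨ 8Z≡ΣGGG (x^k≢0⇒x≢0 5 λ p → ρ≢0 (trans (sym a^6≡) p))
           (x^k≢0⇒x≢0 5 λ p → ρ≢1 (sym (x+y≡0⇒x≡y (trans (sym b^6≡) p)))) a^6≡ b^6≡ ⟩
    Σ (λ μ → G μ ℤ.* G (μ * a) ℤ.* G (μ * b))
      ≡⟨ ΣGGG≡qΣΣE a b ⟩
    + q ℤ.* Σ (λ x → Σ (λ y → E a b x y))
      ≡⟨ cong (+ q ℤ.*_) (ΣΣE≡ a b λ { refl → ρ≢1 (trans (sym a^6≡) (1^k≡1 6)) }) ⟩
    + q ℤ.* (+ q ℤ.* (+ r a b ℤ.- 1ℤ))
      ≡⟨ ℤ.*-assoc (+ q) (+ q) (+ r a b ℤ.- 1ℤ) ⟨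
    + q ℤ.* + q ℤ.* (+ r a b ℤ.- 1ℤ)
      ≡⟨ cong (ℤ._* (+ r a b ℤ.- 1ℤ)) (trans (sym (ℤ.pos-* 8 (2 ℕ.^ (2 ℕ.* n ∸ 3))))
           (trans (cong +_ (8*2^[2n∸3]≡q*q ρ≢0,1)) (ℤ.pos-* q q))) ⟨
    + 8 ℤ.* + (2 ℕ.^ (2 ℕ.* n ∸ 3)) ℤ.* (+ r a b ℤ.- 1ℤ)
      ≡⟨ ℤ.*-assoc (+ 8) (+ (2 ℕ.^ (2 ℕ.* n ∸ 3))) (+ r a b ℤ.- 1ℤ) ⟩
    + 8 ℤ.* (+ (2 ℕ.^ (2 ℕ.* n ∸ 3)) ℤ.* (+ r a b ℤ.- 1ℤ)) ∎)

  -- Sixth roots and the bijection with the curve points.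

  find-satisfies : ∀ {p} {P : Pred Carrier p} (P? : Decidable P) d {x xs} →
    x ∈ xs → P x → P (fromMaybe d (find P? xs))
  find-satisfies P? d {xs = y ∷ ys} x∈ Px with P? y
  ... | yes Py = Py
  find-satisfies P? d (here refl) Px | no ¬Px = contradiction Px ¬Px
  find-satisfies P? d (there x∈)  Px | no _   = find-satisfies P? d x∈ Px

  [x^1/6]^6≡x : ∀ x → (x ^1/6) ^ 6 ≡ x
  [x^1/6]^6≡x x = let y , y^6≡x = injective⇒surjective ^6-injective x in
    find-satisfies (λ y → y ^ 6 ≟ x) 0# (∈-elements y) y^6≡x

  ^1/6-unique : ∀ {x y} → y ^ 6 ≡ x → x ^1/6 ≡ y
  ^1/6-unique p = ^6-injective (trans ([x^1/6]^6≡x _) (sym p))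

  ^6-≢0,1 : ∀ {x} → ≢0,1 x → ≢0,1 (x ^ 6)
  ^6-≢0,1 (x≢0 , x≢1) = x^k≢0 6 x≢0 , λ p → x≢1 (^6-injective (trans p (sym (1^k≡1 6))))

  ^1/6-≢0,1 : ∀ {x} → ≢0,1 x → ≢0,1 (x ^1/6)
  ^1/6-≢0,1 {x} (x≢0 , x≢1) =
    x^k≢0⇒x≢0 5 (λ p → x≢0 (trans (sym ([x^1/6]^6≡x x)) p)) ,
    λ p → x≢1 (trans (sym ([x^1/6]^6≡x x)) (trans (cong (_^ 6) p) (1^k≡1 6)))

  1+-≢0,1 : ∀ {x} → ≢0,1 x → ≢0,1 (1# + x)
  1+-≢0,1 {x} (x≢0 , x≢1) = (λ p → x≢1 (sym (x+y≡0⇒x≡y p))) ,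
    λ p → x≢0 (trans (x+y≡z⇒x≡z+y (trans (+-comm x 1#) p)) (x+x≡0 1#))

  roots : Parameter → CurvePoint
  roots (ρ , ρ≢0,1) = (ρ ^1/6 , (1# + ρ) ^1/6) , ^1/6-≢0,1 ρ≢0,1 , ^1/6-≢0,1 (1+-≢0,1 ρ≢0,1) ,
    trans (cong₂ _+_ ([x^1/6]^6≡x ρ) ([x^1/6]^6≡x (1# + ρ)))
      (solve 1 (λ ρ → ρ :+ (con true :+ ρ) := con true) refl ρ)

  -- The inverse sends (a, b) to a⁶, and the curve equation gives b⁶ = 1 + a⁶. Comparing first
  -- projections identifies points by their field elements, apart from the attached proofs.
  roots-bijective : Bijective (_≡_ on proj₁) (_≡_ on proj₁) roots
  roots-bijective =
    (λ {(ρ , _)} {(ρ′ , _)} p → trans (sym ([x^1/6]^6≡x ρ))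
      (trans (cong ((_^ 6) ∘ proj₁) p) ([x^1/6]^6≡x ρ′))) ,
    λ { ((a , b) , a≢0,1 , _ , a^6+b^6≡1) → (a ^ 6 , ^6-≢0,1 a≢0,1) , λ { {_} refl →
      cong₂ _,_ (^1/6-unique refl)
        (^1/6-unique (x+y≡z⇒x≡z+y (trans (+-comm (b ^ 6) (a ^ 6)) a^6+b^6≡1))) } }

theorem11p9 : ∀ {c} (n : ℕ) → n % 2 ≡ 1 → (K : FiniteField c (2 ℕ.^ n)) →
    let open FiniteField K
        open Kasami n K
    in
    (∀ ρ → ≢0,1 ρ →
      let a = ρ ^1/6
          b = (1# + ρ) ^1/6
      in Z ρ ≡ (+ (2 ℕ.^ (2 ℕ.* n ∸ 3))) ℤ.* ((+ r a b) ℤ.- 1ℤ))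
    ×
    (∃ λ (φ : Parameter → CurvePoint) →
      (∀ p → let ρ = proj₁ p in proj₁ (φ p) ≡ (ρ ^1/6 , (1# + ρ) ^1/6))
      × Bijective (_≡_ on proj₁) (_≡_ on proj₁) φ)
theorem11p9 n n-odd K =
  (λ ρ ρ≢0,1 → Z≡ ρ≢0,1 ([x^1/6]^6≡x ρ) ([x^1/6]^6≡x (1# + ρ))) ,
  roots , (λ _ → refl) , roots-bijective
  where
  open FiniteField K
  open CubicMoment n (n / 2) (trans (m≡m%n+[m/n]*n n 2) (cong (ℕ._+ n / 2 ℕ.* 2) n-odd)) K
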